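{- Let $m\ge 1$ and $n$ be positive integers. For $n\ge 2$, \[ f_m(n,2)=mn+m . \] For $k\in\{3,4\}$ and $n\ge k-1$, \[ mn+(m+1)(k-1)-1\;\le\; f_m(n,k)\;\le\; mn+m\binom{k}{2}. \]
   Context: For positive integers $m,n$ let $mB^n=\{0,1,\ldots,m\}^n\subseteq\mathbb{R}^n$ and let $\mathbf{0}$ denote the origin. A family of hyperplanes in $\mathbb{R}^n$ is a finite multiset of affine hyperplanes (repetitions allowed); a point is covered $t$ times by the family if exactly $t$ members of the family (counted with multiplicity) contain it. For a positive integer $k$, $f_m(n,k)$ denotes the minimum number of hyperplanes in a family such that every point of $mB^n\setminus\{\mathbf{0}\}$ is covered at least $k$ times while $\mathbf{0}$ is not covered by any hyperplane of the family.
   Formalization: The hyperplanes in the families are taken with rational normal vectors and rational offsets rather than real ones, so the minimum f_m(n,k) is over rational families (each real hyperplane missing the origin can be replaced by a rational one containing at least the same grid points). -}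

module Defs where

open import Data.Nat using (ℕ; zero; suc; _≤_)
open import Data.Integer using (+_)
open import Data.Rational using (ℚ; 0ℚ; _/_; _+_; _*_; _≟_)
open import Data.Vec using (Vec; []; _∷_; lookup; replicate)
open import Data.Fin using (Fin)
open import Data.List using (List; []; _∷_)
open import Data.Product using (Σ; _×_)
open import Relation.Binary.PropositionalEquality using (_≡_)
open import Relation.Nullary using (¬_; does)
open import Data.Bool using (if_then_else_)

ℕ→ℚ : ℕ → ℚ
ℕ→ℚ x = + x / 1

record Hyperplane (n : ℕ) : Set where
  field
    normal  : Vec ℚ n
    offset  : ℚ
    nonzero : Σ (Fin n) (λ i → ¬ lookup normal i ≡ 0ℚ)
open Hyperplane public

dot : ∀ {n} → Vec ℚ n → Vec ℕ n → ℚ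
dot [] [] = 0ℚ
dot (a ∷ as) (x ∷ xs) = a * ℕ→ℚ x + dot as xs

_∈H_ : ∀ {n} → Vec ℕ n → Hyperplane n → Set
x ∈H H = dot (normal H) x ≡ offset H

mult : ∀ {n} → List (Hyperplane n) → Vec ℕ n → ℕ
mult [] x = 0
mult (H ∷ F) x =
  if does (dot (normal H) x ≟ offset H) then suc (mult F x) else mult F x

origin : ∀ {n} → Vec ℕ n
origin = replicate _ 0

InGrid : ∀ {n} → ℕ → Vec ℕ n → Set
InGrid m x = ∀ i → lookup x i ≤ m

Valid : (m n k : ℕ) → List (Hyperplane n) → Set
Valid m n k F =
  (∀ (x : Vec ℕ n) → InGrid m x → ¬ x ≡ origin → k ≤ mult F x)
  × mult F origin ≡ 0

{-# OPTIONS --safe #-}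

-- The product P of the affine forms of a family is annihilated by every tensor product of
-- univariate divided differences of total order > |F|. Take coordinate i with the node 0 pᵢ times
-- and each node 1,…,m bᵢ times. As long as the multiplicities are small enough, all contributions
-- from nonzero grid points vanish because P vanishes there to order k, and only Taylor
-- coefficients of P at 0 remain; raising bᵢ by one divides the expansion in xᵢ by ∏ (xᵢ − c).
-- Write Q(p₁,b₁; p₂,b₂; …) for the resulting number, the unlisted coordinates being (1,1).
-- k = 2: Q(1,2) = 0 gives P(0) = 0.
-- k = 3: Q(2,3; 1,1) = 0 and Q(2,2; 1,2) = 0 prescribe two different values of ∂₁P(0)/P(0).
-- k = 4: Q(2,2; 2,2; 1,2) = Q(2,2; 2,3; 1,1) = 0 determine ∂₁P(0)/P(0), and
-- Q(3,3; 1,2) = Q(3,4; 1,1) = 0 give a different value.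
-- The covering family consists of the planes xᵢ = c together with planes x₁ + … + xₙ = j.

module Submission where

open import Defs
open import Data.Nat using (ℕ; zero; suc; _+_; _*_; _∸_; _≤_; _<_; _⊔_; pred; z≤n; s≤s; z<s; s<s; s≤s⁻¹; s<s⁻¹)
open import Data.Nat.Combinatorics using (_C_)
open import Data.List using (List; []; _∷_; _++_; length)
open import Data.Product using (Σ; ∃; ∃₂; _×_; _,_; proj₁; proj₂)
open import Data.Sum using (_⊎_; inj₁; inj₂)
open import Relation.Binary.PropositionalEquality using (_≡_)

open import Data.Bool using (true; false)
open import Data.Empty using (⊥-elim)
open import Data.Fin using (zero; suc)
import Data.Integer as ℤ
import Data.Integer.Properties as ℤₚ
import Data.List as List
import Data.List.Properties as Listₚ
import Data.Nat.Properties as ℕₚ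
open import Data.List.Relation.Unary.All using (All; []; _∷_)
import Data.List.Relation.Unary.All.Properties as Allₚ
open import Data.Nat.Tactic.RingSolver using (solve-∀)
open import Data.Rational using (ℚ; 0ℚ; 1ℚ; 1/_; ≢-nonZero) renaming (_+_ to _+ℚ_; _*_ to _*ℚ_; _-_ to _-ℚ_)
import Data.Rational as ℚ
import Data.Rational.Properties as ℚₚ
import Data.Rational.Unnormalised as ℚᵘ
import Data.Rational.Unnormalised.Properties as ℚᵘₚ
open import Data.Rational.Solver using (module +-*-Solver)
import Data.Vec as Vec
import Data.Vec.Properties as Vecₚ
open import Data.Vec using (Vec; []; _∷_; sum) renaming (replicate to replicateᵛ; map to mapᵛ)
open import Data.Vec.Relation.Binary.Pointwise.Inductive using (Pointwise; []; _∷_)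
open import Data.Vec.Relation.Unary.Any using (Any; here; there)
open import Relation.Binary.PropositionalEquality using (_≢_; refl; sym; trans; cong; cong₂; subst; subst₂; module ≡-Reasoning)
open import Relation.Nullary using (¬_; does; yes; no; contradiction)

open +-*-Solver using (solve; _:+_; _:*_; _:-_; :-_; _:=_; con)

-- Rational arithmetic

*-zero-divisorˡ : ∀ {p q} → p ≢ 0ℚ → p *ℚ q ≡ 0ℚ → q ≡ 0ℚ
*-zero-divisorˡ {p} {q} p≢0 pq≡0 = begin
  q                    ≡⟨ ℚₚ.*-identityˡ q ⟨
  1ℚ *ℚ q              ≡⟨ cong (_*ℚ q) (ℚₚ.*-inverseˡ p) ⟨
  ((1/ p) *ℚ p) *ℚ q   ≡⟨ ℚₚ.*-assoc (1/ p) p q ⟩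
  (1/ p) *ℚ (p *ℚ q)   ≡⟨ cong ((1/ p) *ℚ_) pq≡0 ⟩
  (1/ p) *ℚ 0ℚ         ≡⟨ ℚₚ.*-zeroʳ (1/ p) ⟩
  0ℚ                   ∎
  where
  open ≡-Reasoning
  instance _ = ≢-nonZero p≢0

-- Normalised fractions do not add by computation, so both sides are compared as unnormalised
-- fractions with denominator 1.
ℕ→ℚ-+ : ∀ x y → ℕ→ℚ (x + y) ≡ ℕ→ℚ x +ℚ ℕ→ℚ y
ℕ→ℚ-+ x y = ℚₚ.toℚᵘ-injective (begin
  ℚ.toℚᵘ (ℕ→ℚ (x + y))                         ≈⟨ ℚₚ.toℚᵘ-fromℚᵘ (i (x + y)) ⟩
  i (x + y)                                    ≈⟨ ℚᵘ.*≡* (cong (ℤ._* ℤ.1ℤ) (sym (cong₂ ℤ._+_ (ℤₚ.*-identityʳ (ℤ.+ x)) (ℤₚ.*-identityʳ (ℤ.+ y))))) ⟩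
  i x ℚᵘ.+ i y                                 ≈⟨ ℚᵘₚ.+-cong (ℚₚ.toℚᵘ-fromℚᵘ (i x)) (ℚₚ.toℚᵘ-fromℚᵘ (i y)) ⟨
  ℚ.toℚᵘ (ℕ→ℚ x) ℚᵘ.+ ℚ.toℚᵘ (ℕ→ℚ y)           ≈⟨ ℚₚ.toℚᵘ-homo-+ (ℕ→ℚ x) (ℕ→ℚ y) ⟨
  ℚ.toℚᵘ (ℕ→ℚ x +ℚ ℕ→ℚ y)                      ∎)
  where
  open import Relation.Binary.Reasoning.Setoid ℚᵘₚ.≃-setoid
  i : ℕ → ℚᵘ.ℚᵘ
  i z = ℤ.+ z ℚᵘ./ 1

ℕ→ℚ-* : ∀ x y → ℕ→ℚ (x * y) ≡ ℕ→ℚ x *ℚ ℕ→ℚ y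
ℕ→ℚ-* zero    y = sym (ℚₚ.*-zeroˡ (ℕ→ℚ y))
ℕ→ℚ-* (suc x) y = begin
  ℕ→ℚ (y + x * y)                  ≡⟨ ℕ→ℚ-+ y (x * y) ⟩
  ℕ→ℚ y +ℚ ℕ→ℚ (x * y)             ≡⟨ cong (ℕ→ℚ y +ℚ_) (ℕ→ℚ-* x y) ⟩
  ℕ→ℚ y +ℚ ℕ→ℚ x *ℚ ℕ→ℚ y          ≡⟨ solve 2 (λ x y → y :+ x :* y := (con 1ℚ :+ x) :* y) refl (ℕ→ℚ x) (ℕ→ℚ y) ⟩
  (1ℚ +ℚ ℕ→ℚ x) *ℚ ℕ→ℚ y           ≡⟨ cong (_*ℚ ℕ→ℚ y) (ℕ→ℚ-+ 1 x) ⟨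
  ℕ→ℚ (suc x) *ℚ ℕ→ℚ y             ∎
  where open ≡-Reasoning

ℕ→ℚ-injective : ∀ {x y} → ℕ→ℚ x ≡ ℕ→ℚ y → x ≡ y
ℕ→ℚ-injective {x} {y} eq with ℚₚ.fromℚᵘ-injective {ℤ.+ x ℚᵘ./ 1} {ℤ.+ y ℚᵘ./ 1} eq
... | ℚᵘ.*≡* e = ℤₚ.+-injective (ℤₚ.*-cancelʳ-≡ (ℤ.+ x) (ℤ.+ y) ℤ.1ℤ e)

ℕ→ℚ≢0 : ∀ {x} → x ≢ 0 → ℕ→ℚ x ≢ 0ℚ
ℕ→ℚ≢0 x≢0 eq = x≢0 (ℕ→ℚ-injective eq)

p≢q⇒p-q≢0 : ∀ {p q} → p ≢ q → p -ℚ q ≢ 0ℚ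
p≢q⇒p-q≢0 {p} {q} p≢q eq = p≢q (begin
  p              ≡⟨ solve 2 (λ p q → p := (p :- q) :+ q) refl p q ⟩
  (p -ℚ q) +ℚ q  ≡⟨ cong (_+ℚ q) eq ⟩
  0ℚ +ℚ q        ≡⟨ ℚₚ.+-identityˡ q ⟩
  q              ∎)
  where open ≡-Reasoning

-- Divided differences

Nodes : ℕ → Set
Nodes n = Vec (List ℕ) n

hd : List ℕ → ℕ
hd []      = 0
hd (c ∷ _) = c

tl : List ℕ → List ℕ
tl []      = []
tl (_ ∷ L) = L

-- On a single node the second Leibniz term must be absent, hence the default 0 on the empty list.
on-nonempty : (List ℕ → ℚ) → List ℕ → ℚ
on-nonempty g []      = 0ℚ
on-nonempty g (c ∷ L) = g (c ∷ L)

-- Leibniz rule [c₀,…,c_r](x f) = c₀ [c₀,…,c_r] f + [c₁,…,c_r] f.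
times-x : (List ℕ → ℚ) → List ℕ → ℚ
times-x g L = ℕ→ℚ (hd L) *ℚ g L +ℚ on-nonempty g (tl L)

times-linear : ∀ {n} → Vec ℚ n → (Nodes n → ℚ) → Nodes n → ℚ
times-linear []       G []      = 0ℚ
times-linear (a ∷ as) G (L ∷ N) =
  a *ℚ times-x (λ L′ → G (L′ ∷ N)) L +ℚ times-linear as (λ N′ → G (L ∷ N′)) N

-- The tensor divided difference of the constant polynomial 1; an empty node list counts as the zero
-- functional.
singletons : ∀ {n} → Nodes n → ℚ
singletons []             = 1ℚ
singletons ((_ ∷ []) ∷ N) = singletons N
singletons (_ ∷ N)        = 0ℚ

-- The tensor product of the divided differences with node lists N, applied to
-- the polynomial ∏_{H ∈ F} (normal H · x − offset H).
divdiff : ∀ {n} → List (Hyperplane n) → Nodes n → ℚ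
divdiff []      N = singletons N
divdiff (H ∷ F) N = times-linear (normal H) (divdiff F) N -ℚ offset H *ℚ divdiff F N

-- The recurrence of divided differences

-- The recurrence is cleared of its denominator, so it also makes sense for c = d. The node d may
-- stand anywhere after the head, so a list can be shortened without reordering.
record Recurrent (g : List ℕ → ℚ) : Set where
  constructor recurrent
  field
    recurrence : ∀ c xs d ys →
      (ℕ→ℚ d -ℚ ℕ→ℚ c) *ℚ g (c ∷ xs ++ d ∷ ys) ≡ g (xs ++ d ∷ ys) -ℚ g (c ∷ xs ++ ys)
open Recurrent

data SepRecurrent : ∀ {n} → (Nodes n → ℚ) → Set where
  []  : {G : Nodes 0 → ℚ} → SepRecurrent G
  _∷_ : ∀ {n} {G : Nodes (suc n) → ℚ} →
        (∀ N → Recurrent (λ L → G (L ∷ N))) → (∀ L → SepRecurrent (λ N → G (L ∷ N))) →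
        SepRecurrent G

on-nonempty-++ : ∀ g xs d ys → on-nonempty g (xs ++ d ∷ ys) ≡ g (xs ++ d ∷ ys)
on-nonempty-++ g []       d ys = refl
on-nonempty-++ g (_ ∷ xs) d ys = refl

Recurrent-0 : Recurrent (λ _ → 0ℚ)
Recurrent-0 = recurrent λ c xs d ys → ℚₚ.*-zeroʳ (ℕ→ℚ d -ℚ ℕ→ℚ c)

Recurrent-+ : ∀ {g h} → Recurrent g → Recurrent h → Recurrent (λ L → g L +ℚ h L)
recurrence (Recurrent-+ {g} {h} rg rh) c xs d ys = begin
  k *ℚ (g₁ +ℚ h₁)                    ≡⟨ ℚₚ.*-distribˡ-+ k g₁ h₁ ⟩
  k *ℚ g₁ +ℚ k *ℚ h₁                 ≡⟨ cong₂ _+ℚ_ (recurrence rg c xs d ys) (recurrence rh c xs d ys) ⟩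
  (g₂ -ℚ g₃) +ℚ (h₂ -ℚ h₃)           ≡⟨ solve 4 (λ g₂ g₃ h₂ h₃ → (g₂ :- g₃) :+ (h₂ :- h₃) := (g₂ :+ h₂) :- (g₃ :+ h₃)) refl g₂ g₃ h₂ h₃ ⟩
  (g₂ +ℚ h₂) -ℚ (g₃ +ℚ h₃)           ∎
  where
  open ≡-Reasoning
  k  = ℕ→ℚ d -ℚ ℕ→ℚ c
  g₁ = g (c ∷ xs ++ d ∷ ys)
  g₂ = g (xs ++ d ∷ ys)
  g₃ = g (c ∷ xs ++ ys)
  h₁ = h (c ∷ xs ++ d ∷ ys)
  h₂ = h (xs ++ d ∷ ys)
  h₃ = h (c ∷ xs ++ ys)

Recurrent-* : ∀ a {g} → Recurrent g → Recurrent (λ L → a *ℚ g L)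
recurrence (Recurrent-* a {g} rg) c xs d ys = begin
  k *ℚ (a *ℚ g₁)           ≡⟨ solve 3 (λ k a g → k :* (a :* g) := a :* (k :* g)) refl k a g₁ ⟩
  a *ℚ (k *ℚ g₁)           ≡⟨ cong (a *ℚ_) (recurrence rg c xs d ys) ⟩
  a *ℚ (g₂ -ℚ g₃)          ≡⟨ solve 3 (λ a g₂ g₃ → a :* (g₂ :- g₃) := a :* g₂ :- a :* g₃) refl a g₂ g₃ ⟩
  a *ℚ g₂ -ℚ a *ℚ g₃       ∎
  where
  open ≡-Reasoning
  k  = ℕ→ℚ d -ℚ ℕ→ℚ c
  g₁ = g (c ∷ xs ++ d ∷ ys)
  g₂ = g (xs ++ d ∷ ys)
  g₃ = g (c ∷ xs ++ ys)

Recurrent-times-x : ∀ {g} → Recurrent g → Recurrent (times-x g)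
recurrence (Recurrent-times-x {g} rg) c [] d ys = begin
  (d′ -ℚ c′) *ℚ (c′ *ℚ α +ℚ β)
    ≡⟨ solve 4 (λ c d α β → (d :- c) :* (c :* α :+ β) := c :* ((d :- c) :* α) :+ (d :- c) :* β) refl c′ d′ α β ⟩
  c′ *ℚ ((d′ -ℚ c′) *ℚ α) +ℚ (d′ -ℚ c′) *ℚ β
    ≡⟨ cong (λ z → c′ *ℚ z +ℚ (d′ -ℚ c′) *ℚ β) (recurrence rg c [] d ys) ⟩
  c′ *ℚ (β -ℚ γ) +ℚ (d′ -ℚ c′) *ℚ β
    ≡⟨ solve 5 (λ c d β γ ε → c :* (β :- γ) :+ (d :- c) :* β := (d :* β :+ ε) :- (c :* γ :+ ε)) refl c′ d′ β γ ε ⟩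
  (d′ *ℚ β +ℚ ε) -ℚ (c′ *ℚ γ +ℚ ε) ∎
  where
  open ≡-Reasoning
  c′ = ℕ→ℚ c
  d′ = ℕ→ℚ d
  α = g (c ∷ d ∷ ys)
  β = g (d ∷ ys)
  γ = g (c ∷ ys)
  ε = on-nonempty g ys
recurrence (Recurrent-times-x {g} rg) c (e ∷ xs) d ys = begin
  (d′ -ℚ c′) *ℚ (c′ *ℚ α +ℚ β)
    -- Writing d - c as (e - c) + (d - e) makes the recurrence with head e applicable to the second
    -- Leibniz term.
    ≡⟨ solve 5 (λ c d e α β → (d :- c) :* (c :* α :+ β) := c :* ((d :- c) :* α) :+ (e :- c) :* β :+ (d :- e) :* β) refl c′ d′ e′ α β ⟩
  c′ *ℚ ((d′ -ℚ c′) *ℚ α) +ℚ (e′ -ℚ c′) *ℚ β +ℚ (d′ -ℚ e′) *ℚ β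
    ≡⟨ cong₂ (λ z w → c′ *ℚ z +ℚ (e′ -ℚ c′) *ℚ β +ℚ w) (recurrence rg c (e ∷ xs) d ys) (recurrence rg e xs d ys) ⟩
  c′ *ℚ (β -ℚ γ) +ℚ (e′ -ℚ c′) *ℚ β +ℚ (ε -ℚ δ)
    ≡⟨ solve 6 (λ c e β γ δ ε → c :* (β :- γ) :+ (e :- c) :* β :+ (ε :- δ) := (e :* β :+ ε) :- (c :* γ :+ δ)) refl c′ e′ β γ δ ε ⟩
  (e′ *ℚ β +ℚ ε) -ℚ (c′ *ℚ γ +ℚ δ)
    ≡⟨ cong (λ z → (e′ *ℚ β +ℚ z) -ℚ (c′ *ℚ γ +ℚ δ)) (on-nonempty-++ g xs d ys) ⟨
  (e′ *ℚ β +ℚ on-nonempty g (xs ++ d ∷ ys)) -ℚ (c′ *ℚ γ +ℚ δ) ∎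
  where
  open ≡-Reasoning
  c′ = ℕ→ℚ c
  d′ = ℕ→ℚ d
  e′ = ℕ→ℚ e
  α = g (c ∷ e ∷ xs ++ d ∷ ys)
  β = g (e ∷ xs ++ d ∷ ys)
  γ = g (c ∷ e ∷ xs ++ ys)
  δ = g (e ∷ xs ++ ys)
  ε = g (xs ++ d ∷ ys)

SepRecurrent-0 : ∀ {n} → SepRecurrent {n} (λ _ → 0ℚ)
SepRecurrent-0 {zero}  = []
SepRecurrent-0 {suc n} = (λ _ → Recurrent-0) ∷ λ _ → SepRecurrent-0

SepRecurrent-+ : ∀ {n} {G H : Nodes n → ℚ} → SepRecurrent G → SepRecurrent H →
  SepRecurrent (λ N → G N +ℚ H N)
SepRecurrent-+ {zero}  _ _ = []
SepRecurrent-+ {suc n} (rG ∷ sG) (rH ∷ sH) =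
  (λ N → Recurrent-+ (rG N) (rH N)) ∷ λ L → SepRecurrent-+ (sG L) (sH L)

SepRecurrent-* : ∀ {n} a {G : Nodes n → ℚ} → SepRecurrent G → SepRecurrent (λ N → a *ℚ G N)
SepRecurrent-* {zero}  a _ = []
SepRecurrent-* {suc n} a (rG ∷ sG) = (λ N → Recurrent-* a (rG N)) ∷ λ L → SepRecurrent-* a (sG L)

SepRecurrent-on-nonempty : ∀ {n} {G : Nodes (suc n) → ℚ} → (∀ L → SepRecurrent (λ N → G (L ∷ N))) →
  ∀ L → SepRecurrent (λ N → on-nonempty (λ L′ → G (L′ ∷ N)) L)
SepRecurrent-on-nonempty sG []      = SepRecurrent-0
SepRecurrent-on-nonempty sG (c ∷ L) = sG (c ∷ L)

-- `times-linear` is linear in the functional. With `k` the difference of two nodes of another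
-- coordinate, this carries the recurrence in that coordinate through the multiplication.
times-linear-preserves : ∀ {n} (as : Vec ℚ n) k {G G₁ G₂ : Nodes n → ℚ} →
  (∀ N → k *ℚ G N ≡ G₁ N -ℚ G₂ N) →
  ∀ N → k *ℚ times-linear as G N ≡ times-linear as G₁ N -ℚ times-linear as G₂ N
times-linear-preserves []       k eq []      = ℚₚ.*-zeroʳ k
times-linear-preserves (a ∷ as) k {G} {G₁} {G₂} eq (L ∷ N) = begin
  k *ℚ (a *ℚ (h *ℚ x +ℚ y) +ℚ z)
    ≡⟨ solve 6 (λ k a h x y z → k :* (a :* (h :* x :+ y) :+ z) := a :* (h :* (k :* x) :+ k :* y) :+ k :* z) refl k a h x y z ⟩
  a *ℚ (h *ℚ (k *ℚ x) +ℚ k *ℚ y) +ℚ k *ℚ z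
    ≡⟨ cong₂ _+ℚ_ (cong (a *ℚ_) (cong₂ (λ u v → h *ℚ u +ℚ v) (eq (L ∷ N)) (tail-eq (tl L))))
                  (times-linear-preserves as k (λ N′ → eq (L ∷ N′)) N) ⟩
  a *ℚ (h *ℚ (x₁ -ℚ x₂) +ℚ (y₁ -ℚ y₂)) +ℚ (z₁ -ℚ z₂)
    ≡⟨ solve 8 (λ a h x₁ x₂ y₁ y₂ z₁ z₂ →
         a :* (h :* (x₁ :- x₂) :+ (y₁ :- y₂)) :+ (z₁ :- z₂) :=
         (a :* (h :* x₁ :+ y₁) :+ z₁) :- (a :* (h :* x₂ :+ y₂) :+ z₂)) refl a h x₁ x₂ y₁ y₂ z₁ z₂ ⟩
  (a *ℚ (h *ℚ x₁ +ℚ y₁) +ℚ z₁) -ℚ (a *ℚ (h *ℚ x₂ +ℚ y₂) +ℚ z₂) ∎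
  where
  open ≡-Reasoning
  tail-eq : ∀ L → k *ℚ on-nonempty (λ L′ → G (L′ ∷ N)) L
                ≡ on-nonempty (λ L′ → G₁ (L′ ∷ N)) L -ℚ on-nonempty (λ L′ → G₂ (L′ ∷ N)) L
  tail-eq []      = ℚₚ.*-zeroʳ k
  tail-eq (c ∷ L) = eq ((c ∷ L) ∷ N)
  h  = ℕ→ℚ (hd L)
  x  = G (L ∷ N)
  x₁ = G₁ (L ∷ N)
  x₂ = G₂ (L ∷ N)
  y  = on-nonempty (λ L′ → G (L′ ∷ N)) (tl L)
  y₁ = on-nonempty (λ L′ → G₁ (L′ ∷ N)) (tl L)
  y₂ = on-nonempty (λ L′ → G₂ (L′ ∷ N)) (tl L)
  z  = times-linear as (λ N′ → G (L ∷ N′)) N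
  z₁ = times-linear as (λ N′ → G₁ (L ∷ N′)) N
  z₂ = times-linear as (λ N′ → G₂ (L ∷ N′)) N

SepRecurrent-times-linear : ∀ {n} (as : Vec ℚ n) {G : Nodes n → ℚ} →
  SepRecurrent G → SepRecurrent (times-linear as G)
SepRecurrent-times-linear []       _         = []
SepRecurrent-times-linear (a ∷ as) {G} (rG ∷ sG) =
  (λ N → Recurrent-+
           (Recurrent-* a (Recurrent-times-x (rG N)))
           (recurrent λ c xs d ys → times-linear-preserves as (ℕ→ℚ d -ℚ ℕ→ℚ c)
              (λ N′ → recurrence (rG N′) c xs d ys) N)) ∷
  λ L → SepRecurrent-+
          (SepRecurrent-* a (SepRecurrent-+ (SepRecurrent-* (ℕ→ℚ (hd L)) (sG L))
                                            (SepRecurrent-on-nonempty {G = G} sG (tl L))))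
          (SepRecurrent-times-linear as (sG L))

SepRecurrent-cong : ∀ {n} {G H : Nodes n → ℚ} → (∀ N → G N ≡ H N) → SepRecurrent G → SepRecurrent H
SepRecurrent-cong {zero}  eq _ = []
SepRecurrent-cong {suc n} eq (rG ∷ sG) =
  (λ N → recurrent λ c xs d ys →
     subst₂ _≡_ (cong ((ℕ→ℚ d -ℚ ℕ→ℚ c) *ℚ_) (eq _)) (cong₂ _-ℚ_ (eq _) (eq _)) (recurrence (rG N) c xs d ys)) ∷
  λ L → SepRecurrent-cong (λ N → eq (L ∷ N)) (sG L)

SepRecurrent-singletons : ∀ {n} → SepRecurrent (singletons {n})
SepRecurrent-singletons {zero}  = []
SepRecurrent-singletons {suc n} = rec ∷ sep
  where
  rec : ∀ N → Recurrent (λ L → singletons (L ∷ N))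
  recurrence (rec N) c []           d []      =
    trans (ℚₚ.*-zeroʳ (ℕ→ℚ d -ℚ ℕ→ℚ c)) (sym (ℚₚ.+-inverseʳ (singletons N)))
  recurrence (rec N) c []           d (_ ∷ _) = ℚₚ.*-zeroʳ (ℕ→ℚ d -ℚ ℕ→ℚ c)
  recurrence (rec N) c (_ ∷ [])     d ys      = ℚₚ.*-zeroʳ (ℕ→ℚ d -ℚ ℕ→ℚ c)
  recurrence (rec N) c (_ ∷ _ ∷ _)  d ys      = ℚₚ.*-zeroʳ (ℕ→ℚ d -ℚ ℕ→ℚ c)

  sep : ∀ L → SepRecurrent (λ N → singletons (L ∷ N))
  sep []          = SepRecurrent-0
  sep (_ ∷ [])    = SepRecurrent-singletons
  sep (_ ∷ _ ∷ _) = SepRecurrent-0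

SepRecurrent-divdiff : ∀ {n} (F : List (Hyperplane n)) → SepRecurrent (divdiff F)
SepRecurrent-divdiff []      = SepRecurrent-singletons
SepRecurrent-divdiff (H ∷ F) =
  SepRecurrent-cong (λ N → cong (times-linear (normal H) (divdiff F) N +ℚ_)
                             (sym (ℚₚ.neg-distribˡ-* (offset H) (divdiff F N))))
    (SepRecurrent-+ (SepRecurrent-times-linear (normal H) rF)
                    (SepRecurrent-* (ℚ.- offset H) rF))
  where rF = SepRecurrent-divdiff F

-- Degree and vanishing order

-- Exactly the lower terms that the Leibniz rule produces: one list loses its head and stays
-- nonempty.
data _◁_ : ∀ {n} → Nodes n → Nodes n → Set where
  here  : ∀ {n c d L} {N : Nodes n} → ((d ∷ L) ∷ N) ◁ ((c ∷ d ∷ L) ∷ N)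
  there : ∀ {n L} {N′ N : Nodes n} → N′ ◁ N → (L ∷ N′) ◁ (L ∷ N)

times-linear-◁ : ∀ {n} (as : Vec ℚ n) {G : Nodes n → ℚ} {N} → (∀ {N′} → N′ ◁ N → G N′ ≡ 0ℚ) →
  times-linear as G N ≡ dot as (mapᵛ hd N) *ℚ G N
times-linear-◁ []       {G} {[]}    _    = sym (ℚₚ.*-zeroˡ (G []))
times-linear-◁ (a ∷ as) {G} {L ∷ N} zero◁ = begin
  a *ℚ (h *ℚ g +ℚ on-nonempty (λ L′ → G (L′ ∷ N)) (tl L)) +ℚ times-linear as (λ N′ → G (L ∷ N′)) N
    ≡⟨ cong₂ (λ y z → a *ℚ (h *ℚ g +ℚ y) +ℚ z) (tail-zero L zero◁) (times-linear-◁ as (λ lt → zero◁ (there lt))) ⟩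
  a *ℚ (h *ℚ g +ℚ 0ℚ) +ℚ e *ℚ g
    ≡⟨ solve 4 (λ a h g e → a :* (h :* g :+ con 0ℚ) :+ e :* g := (a :* h :+ e) :* g) refl a h g e ⟩
  (a *ℚ h +ℚ e) *ℚ g ∎
  where
  open ≡-Reasoning
  h = ℕ→ℚ (hd L)
  g = G (L ∷ N)
  e = dot as (mapᵛ hd N)
  tail-zero : ∀ L → (∀ {N′} → N′ ◁ (L ∷ N) → G N′ ≡ 0ℚ) → on-nonempty (λ L′ → G (L′ ∷ N)) (tl L) ≡ 0ℚ
  tail-zero []          _ = refl
  tail-zero (_ ∷ [])    _ = refl
  tail-zero (_ ∷ _ ∷ _) z = z here

-- Once the lower Leibniz terms vanish, a factor of the product comes out as its value at the point
-- of head nodes. The degree bound, the vanishing order and the value at the origin all rest on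
-- this.
divdiff-◁ : ∀ {n} (H : Hyperplane n) F {N} → (∀ {N′} → N′ ◁ N → divdiff F N′ ≡ 0ℚ) →
  divdiff (H ∷ F) N ≡ (dot (normal H) (mapᵛ hd N) -ℚ offset H) *ℚ divdiff F N
divdiff-◁ H F {N} zero◁ = begin
  times-linear (normal H) (divdiff F) N -ℚ offset H *ℚ divdiff F N
    ≡⟨ cong (_-ℚ offset H *ℚ divdiff F N) (times-linear-◁ (normal H) zero◁) ⟩
  e *ℚ divdiff F N -ℚ offset H *ℚ divdiff F N
    ≡⟨ solve 3 (λ e o g → e :* g :- o :* g := (e :- o) :* g) refl e (offset H) (divdiff F N) ⟩
  (e -ℚ offset H) *ℚ divdiff F N ∎
  where
  open ≡-Reasoning
  e = dot (normal H) (mapᵛ hd N)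

size : ∀ {n} → Nodes n → ℕ
size N = sum (mapᵛ length N)

size-◁ : ∀ {n} {N′ N : Nodes n} → N′ ◁ N → suc (size N′) ≡ size N
size-◁ here              = refl
size-◁ (there {L = L} lt) = trans (sym (ℕₚ.+-suc (length L) _)) (cong (length L +_) (size-◁ lt))

singletons-size : ∀ {n} (N : Nodes n) → n < size N → singletons N ≡ 0ℚ
singletons-size ([] ∷ N)          _  = refl
singletons-size ((_ ∷ []) ∷ N)    lt = singletons-size N (s<s⁻¹ lt)
singletons-size ((_ ∷ _ ∷ _) ∷ N) _  = refl

-- Removing a factor lowers the degree by one, and passing to a lower term lowers the number of
-- nodes by one, so the strict inequality survives in both recursive calls.
divdiff-degree : ∀ {n} (F : List (Hyperplane n)) N → length F + n < size N → divdiff F N ≡ 0ℚ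
divdiff-degree []      N lt = singletons-size N lt
divdiff-degree (H ∷ F) N lt = begin
  divdiff (H ∷ F) N    ≡⟨ divdiff-◁ H F (λ N′◁N → divdiff-degree F _ (s<s⁻¹ (subst (_ <_) (sym (size-◁ N′◁N)) lt))) ⟩
  e *ℚ divdiff F N     ≡⟨ cong (e *ℚ_) (divdiff-degree F N (ℕₚ.<-trans (ℕₚ.n<1+n _) lt)) ⟩
  e *ℚ 0ℚ              ≡⟨ ℚₚ.*-zeroʳ e ⟩
  0ℚ                   ∎
  where
  open ≡-Reasoning
  e = dot (normal H) (mapᵛ hd N) -ℚ offset H

-- With each `x` entry repeated one more time than the `ρ` entry, the divided difference is the
-- Taylor coefficient of order `ρ` at `x`.
confluent : ∀ {n} → Vec ℕ n → Vec ℕ n → Nodes n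
confluent []      []      = []
confluent (c ∷ x) (r ∷ ρ) = List.replicate (suc r) c ∷ confluent x ρ

hd-confluent : ∀ {n} (x ρ : Vec ℕ n) → mapᵛ hd (confluent x ρ) ≡ x
hd-confluent []      []      = refl
hd-confluent (c ∷ x) (r ∷ ρ) = cong (c ∷_) (hd-confluent x ρ)

◁-confluent : ∀ {n} (x ρ : Vec ℕ n) {N} → N ◁ confluent x ρ → ∃ λ ρ′ → N ≡ confluent x ρ′ × sum ρ ≡ suc (sum ρ′)
◁-confluent (c ∷ x) (suc r ∷ ρ) here = r ∷ ρ , refl , refl
◁-confluent (c ∷ x) (r ∷ ρ) (there lt) with ◁-confluent x ρ lt
... | ρ′ , refl , eq = r ∷ ρ′ , refl , trans (cong (r +_) eq) (ℕₚ.+-suc r _)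

-- A factor vanishing at `x` kills the leading term, and the lower terms have order one less, which
-- pays for the lost factor. A factor not vanishing at `x` leaves the multiplicity unchanged.
divdiff-confluent : ∀ {n} (F : List (Hyperplane n)) x ρ → sum ρ < mult F x → divdiff F (confluent x ρ) ≡ 0ℚ
divdiff-confluent (H ∷ F) x ρ lt with dot (normal H) x ℚ.≟ offset H
... | yes eq = begin
  divdiff (H ∷ F) N                                           ≡⟨ divdiff-◁ H F zero◁ ⟩
  (dot (normal H) (mapᵛ hd N) -ℚ offset H) *ℚ divdiff F N     ≡⟨ cong (λ y → (dot (normal H) y -ℚ offset H) *ℚ divdiff F N) (hd-confluent x ρ) ⟩
  (dot (normal H) x -ℚ offset H) *ℚ divdiff F N               ≡⟨ cong (λ y → (y -ℚ offset H) *ℚ divdiff F N) eq ⟩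
  (offset H -ℚ offset H) *ℚ divdiff F N                       ≡⟨ solve 2 (λ o g → (o :- o) :* g := con 0ℚ) refl (offset H) (divdiff F N) ⟩
  0ℚ                                                          ∎
  where
  open ≡-Reasoning
  N = confluent x ρ
  zero◁ : ∀ {N′} → N′ ◁ N → divdiff F N′ ≡ 0ℚ
  zero◁ N′◁N with ◁-confluent x ρ N′◁N
  ... | ρ′ , refl , e = divdiff-confluent F x ρ′ (s<s⁻¹ (subst (_< _) e lt))
... | no _ = begin
  divdiff (H ∷ F) N    ≡⟨ divdiff-◁ H F zero◁ ⟩
  e *ℚ divdiff F N     ≡⟨ cong (e *ℚ_) (divdiff-confluent F x ρ lt) ⟩
  e *ℚ 0ℚ              ≡⟨ ℚₚ.*-zeroʳ e ⟩
  0ℚ                   ∎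
  where
  open ≡-Reasoning
  N = confluent x ρ
  e = dot (normal H) (mapᵛ hd N) -ℚ offset H
  zero◁ : ∀ {N′} → N′ ◁ N → divdiff F N′ ≡ 0ℚ
  zero◁ N′◁N with ◁-confluent x ρ N′◁N
  ... | ρ′ , refl , e = divdiff-confluent F x ρ′ (ℕₚ.<-trans (ℕₚ.≤-reflexive (sym e)) lt)

-- With a single node 0 per coordinate there are no lower terms, so the value is the product of the
-- forms at the origin.
divdiff-origin : ∀ {n} (F : List (Hyperplane n)) → mult F origin ≡ 0 → divdiff F (replicateᵛ n (0 ∷ [])) ≢ 0ℚ
divdiff-origin {n} [] _ eq = contradiction (trans (sym (one n)) eq) λ ()
  where
  one : ∀ n → singletons (replicateᵛ n (0 ∷ [])) ≡ 1ℚ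
  one zero    = refl
  one (suc n) = one n
divdiff-origin {n} (H ∷ F) m0 eq with dot (normal H) origin ℚ.≟ offset H
... | yes _  = contradiction m0 λ ()
... | no  ≢o = divdiff-origin F m0 (*-zero-divisorˡ (p≢q⇒p-q≢0 ≢o) (trans (sym expand) eq))
  where
  minimal : ∀ n {N′} → ¬ N′ ◁ replicateᵛ n (0 ∷ [])
  minimal (suc n) (there lt) = minimal n lt

  expand : divdiff (H ∷ F) (replicateᵛ n (0 ∷ [])) ≡ (dot (normal H) origin -ℚ offset H) *ℚ divdiff F (replicateᵛ n (0 ∷ []))
  expand = trans (divdiff-◁ H F (λ lt → ⊥-elim (minimal n lt)))
    (cong (λ y → (dot (normal H) y -ℚ offset H) *ℚ divdiff F (replicateᵛ n (0 ∷ []))) (Vecₚ.map-replicate hd (0 ∷ []) n))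

-- Multiplicities of nodes

δ : ℕ → ℕ → ℕ
δ zero    zero    = 1
δ zero    (suc _) = 0
δ (suc _) zero    = 0
δ (suc c) (suc d) = δ c d

δ-refl : ∀ c → δ c c ≡ 1
δ-refl zero    = refl
δ-refl (suc c) = δ-refl c

δ-≢ : ∀ {c d} → c ≢ d → δ c d ≡ 0
δ-≢ {zero}  {zero}  c≢d = contradiction refl c≢d
δ-≢ {zero}  {suc d} c≢d = refl
δ-≢ {suc c} {zero}  c≢d = refl
δ-≢ {suc c} {suc d} c≢d = δ-≢ λ c≡d → c≢d (cong suc c≡d)

δ≤1 : ∀ c d → δ c d ≤ 1
δ≤1 zero    zero    = ℕₚ.≤-refl
δ≤1 zero    (suc _) = z≤n
δ≤1 (suc _) zero    = z≤n
δ≤1 (suc c) (suc d) = δ≤1 c d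

count : ℕ → List ℕ → ℕ
count c []      = 0
count c (d ∷ L) = δ c d + count c L

count-++ : ∀ c xs ys → count c (xs ++ ys) ≡ count c xs + count c ys
count-++ c []       ys = refl
count-++ c (d ∷ xs) ys = trans (cong (δ c d +_) (count-++ c xs ys)) (sym (ℕₚ.+-assoc (δ c d) _ _))

count-remove : ∀ c xs d ys → count c (xs ++ ys) ≤ count c (xs ++ d ∷ ys)
count-remove c []       d ys = ℕₚ.m≤n+m _ (δ c d)
count-remove c (e ∷ xs) d ys = ℕₚ.+-monoʳ-≤ (δ c e) (count-remove c xs d ys)

count-replicate : ∀ c r → count c (List.replicate r c) ≡ r
count-replicate c zero    = refl
count-replicate c (suc r) = cong₂ _+_ (δ-refl c) (count-replicate c r)

count-replicate-0 : ∀ c p → count (suc c) (List.replicate p 0) ≡ 0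
count-replicate-0 c zero    = refl
count-replicate-0 c (suc p) = count-replicate-0 c p

positives : ℕ → List ℕ
positives zero    = []
positives (suc m) = suc m ∷ positives m

copies : ℕ → ℕ → List ℕ
copies m zero    = []
copies m (suc b) = positives m ++ copies m b

-- The shape (p , b) stands for the node 0 taken p times and each of 1,…,m taken b times.
Shape : Set
Shape = ℕ × ℕ

nodes : ℕ → Shape → List ℕ
nodes m (p , b) = List.replicate p 0 ++ copies m b

count-positives-> : ∀ {c} m → m ≤ c → count (suc c) (positives m) ≡ 0
count-positives-> zero        _  = refl
count-positives-> {c} (suc m) lt = cong₂ _+_ (δ-≢ {c} {m} λ { refl → ℕₚ.n≮n _ lt }) (count-positives-> m (ℕₚ.<⇒≤ lt))

count-positives-≤ : ∀ c m → count (suc c) (positives m) ≤ 1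
count-positives-≤ c zero    = z≤n
count-positives-≤ c (suc m) with m ℕₚ.≤? c
... | yes m≤c = subst (_≤ 1) (sym (trans (cong (δ c m +_) (count-positives-> m m≤c)) (ℕₚ.+-identityʳ _))) (δ≤1 c m)
... | no  m≰c = subst (_≤ 1) (sym (cong (_+ count (suc c) (positives m)) (δ-≢ {c} {m} λ { refl → m≰c ℕₚ.≤-refl })))
                  (count-positives-≤ c m)

count-positives-mono : ∀ c {i m} → i ≤ m → count c (positives i) ≤ count c (positives m)
count-positives-mono c {i} {m} i≤m with ℕₚ.m≤n⇒m<n∨m≡n i≤m
... | inj₂ refl = ℕₚ.≤-refl
count-positives-mono c {i} {suc m} i≤m | inj₁ i<m =
  ℕₚ.≤-trans (count-positives-mono c (s≤s⁻¹ i<m)) (ℕₚ.m≤n+m _ (δ c (suc m)))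

count-0-copies : ∀ m b → count 0 (copies m b) ≡ 0
count-0-copies m zero    = refl
count-0-copies m (suc b) = trans (count-++ 0 (positives m) _) (cong₂ _+_ (count-0-positives m) (count-0-copies m b))
  where
  count-0-positives : ∀ m → count 0 (positives m) ≡ 0
  count-0-positives zero    = refl
  count-0-positives (suc m) = count-0-positives m

count-copies-≤ : ∀ c m b → count (suc c) (copies m b) ≤ b
count-copies-≤ c m zero    = z≤n
count-copies-≤ c m (suc b) = subst (_≤ suc b) (sym (count-++ (suc c) (positives m) _))
  (ℕₚ.+-mono-≤ (count-positives-≤ c m) (count-copies-≤ c m b))

count-copies-> : ∀ {c} m b → m ≤ c → count (suc c) (copies m b) ≡ 0
count-copies-> m zero    m≤c = refl
count-copies-> m (suc b) m≤c = trans (count-++ _ (positives m) _) (cong₂ _+_ (count-positives-> m m≤c) (count-copies-> m b m≤c))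

count-0-nodes : ∀ m p b → count 0 (nodes m (p , b)) ≡ p
count-0-nodes m p b = begin
  count 0 (List.replicate p 0 ++ copies m b)            ≡⟨ count-++ 0 (List.replicate p 0) _ ⟩
  count 0 (List.replicate p 0) + count 0 (copies m b)   ≡⟨ cong₂ _+_ (count-replicate 0 p) (count-0-copies m b) ⟩
  p + 0                                                 ≡⟨ ℕₚ.+-identityʳ p ⟩
  p                                                     ∎
  where open ≡-Reasoning

count-suc-nodes : ∀ c m p b → count (suc c) (nodes m (p , b)) ≡ count (suc c) (copies m b)
count-suc-nodes c m p b = trans (count-++ (suc c) (List.replicate p 0) _) (cong (_+ count (suc c) (copies m b)) (count-replicate-0 c p))

-- Inclusion of multisets, which is inherited when the recurrence deletes nodes at arbitrary
-- positions.
record Fits (m : ℕ) (s : Shape) (L : List ℕ) : Set where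
  constructor _,_
  field
    nonempty : L ≢ []
    bounded  : ∀ c → count c L ≤ count c (nodes m s)

-- The highest derivative order that a confluent sublist of the shape can involve: r + 1 equal nodes
-- give order r.
order : Shape → ℕ
order (p , b) = pred (p ⊔ b)

cost : ∀ {n} → Vec Shape n → ℕ
cost σ = sum (mapᵛ order σ)

-- Some coordinate lacks the node 0, so no point formed from the nodes is the origin.
Omits0 : ∀ {n} → Vec Shape n → Set
Omits0 = Any (λ s → proj₁ s ≡ 0)

fits-replicate : ∀ {m p b c r} → Fits m (p , b) (List.replicate (suc r) c) →
  c ≤ m × r ≤ order (p , b) × (p ≡ 0 → c ≢ 0)
fits-replicate {m} {p} {b} {zero} {r} (_ , fit) =
  z≤n , ℕₚ.pred-mono-≤ (ℕₚ.≤-trans r<p (ℕₚ.m≤m⊔n p b)) , λ { refl _ → contradiction r<p λ () }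
  where
  r<p : suc r ≤ p
  r<p = subst₂ _≤_ (count-replicate 0 (suc r)) (count-0-nodes m p b) (fit 0)
fits-replicate {m} {p} {b} {suc c} {r} (_ , fit) =
  ℕₚ.≰⇒> (λ m≤c → contradiction (subst (suc r ≤_) (count-copies-> m b m≤c) r<count) λ ()) ,
  ℕₚ.pred-mono-≤ (ℕₚ.≤-trans (ℕₚ.≤-trans r<count (count-copies-≤ c m b)) (ℕₚ.m≤n⊔m p b)) , λ _ ()
  where
  r<count : suc r ≤ count (suc c) (copies m b)
  r<count = subst₂ _≤_ (count-replicate (suc c) (suc r)) (count-suc-nodes c m p b) (fit (suc c))

-- Reduction to confluent nodes

uniform-or-distinct : ∀ c L → (∃ λ r → L ≡ List.replicate r c)
  ⊎ (∃₂ λ xs d → ∃ λ ys → d ≢ c × L ≡ xs ++ d ∷ ys)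
uniform-or-distinct c [] = inj₁ (0 , refl)
uniform-or-distinct c (d ∷ L) with d ℕₚ.≟ c
... | no d≢c = inj₂ ([] , d , L , d≢c , refl)
... | yes refl with uniform-or-distinct c L
...   | inj₁ (r , refl)                = inj₁ (suc r , refl)
...   | inj₂ (xs , e , ys , e≢c , refl) = inj₂ (d ∷ xs , e , ys , e≢c , refl)

length-remove : ∀ (xs : List ℕ) d ys → length (xs ++ d ∷ ys) ≡ suc (length (xs ++ ys))
length-remove []       d ys = refl
length-remove (_ ∷ xs) d ys = cong suc (length-remove xs d ys)

++∷≢[] : ∀ (xs : List ℕ) {d ys} → xs ++ d ∷ ys ≢ []
++∷≢[] []      ()
++∷≢[] (_ ∷ _) ()

-- If two nodes c and d differ, the recurrence can be divided by d - c and expresses the value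
-- through two shorter lists that still fit. The descent ends at lists of equal nodes.
Recurrent-vanish : ∀ {m s g} → Recurrent g →
  (∀ c r → Fits m s (List.replicate (suc r) c) → g (List.replicate (suc r) c) ≡ 0ℚ) →
  ∀ L → Fits m s L → g L ≡ 0ℚ
Recurrent-vanish {m} {s} {g} rg base L fit = go (length L) L ℕₚ.≤-refl fit
  where
  go : ∀ fuel L → length L ≤ fuel → Fits m s L → g L ≡ 0ℚ
  go _ [] _ (≢[] , _) = contradiction refl ≢[]
  go (suc fuel) (c ∷ L) len (_ , fit) with uniform-or-distinct c L
  ... | inj₁ (r , refl) = base c r ((λ ()) , fit)
  ... | inj₂ (xs , d , ys , d≢c , refl) =
    *-zero-divisorˡ (p≢q⇒p-q≢0 (λ eq → d≢c (ℕ→ℚ-injective eq))) (begin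
      (ℕ→ℚ d -ℚ ℕ→ℚ c) *ℚ g (c ∷ xs ++ d ∷ ys)   ≡⟨ recurrence rg c xs d ys ⟩
      g (xs ++ d ∷ ys) -ℚ g (c ∷ xs ++ ys)        ≡⟨ cong₂ _-ℚ_ without-c without-d ⟩
      0ℚ -ℚ 0ℚ                                    ≡⟨⟩
      0ℚ                                          ∎)
    where
    open ≡-Reasoning
    without-c : g (xs ++ d ∷ ys) ≡ 0ℚ
    without-c = go fuel (xs ++ d ∷ ys) (s≤s⁻¹ len)
      (++∷≢[] xs , λ e → ℕₚ.≤-trans (ℕₚ.m≤n+m _ (δ e c)) (fit e))
    without-d : g (c ∷ xs ++ ys) ≡ 0ℚ
    without-d = go fuel (c ∷ xs ++ ys) (subst (_≤ fuel) (length-remove xs d ys) (s≤s⁻¹ len))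
      ((λ ()) , λ e → ℕₚ.≤-trans (count-remove e (c ∷ xs) d ys) (fit e))

SepRecurrent-vanish : ∀ {m n} {G : Nodes n → ℚ} → SepRecurrent G → ∀ {σ : Vec Shape n} {N} →
  (∀ x ρ → Pointwise (Fits m) σ (confluent x ρ) → G (confluent x ρ) ≡ 0ℚ) →
  Pointwise (Fits m) σ N → G N ≡ 0ℚ
SepRecurrent-vanish []        base []          = base [] [] []
SepRecurrent-vanish (rG ∷ sG) base (fit ∷ fits) =
  Recurrent-vanish (rG _) (λ c r fit′ →
    SepRecurrent-vanish (sG _) (λ x ρ fits′ → base (c ∷ x) (r ∷ ρ) (fit′ ∷ fits′)) fits) _ fit

-- The trace that covering every nonzero grid point `k` times leaves on the functional. In contrast
-- to the covering itself it passes to functionals with some coordinates fixed.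
record Punctured (m k : ℕ) {n} (G : Nodes n → ℚ) : Set where
  field
    separately : SepRecurrent G
    vanishes   : ∀ {σ : Vec Shape n} {N} → Pointwise (Fits m) σ N → Omits0 σ → cost σ < k → G N ≡ 0ℚ
open Punctured

-- Reduction to confluent nodes leaves Taylor coefficients at nonzero grid points, of order at most
-- `cost σ`, hence below the multiplicity `k`.
divdiff-punctured : ∀ {m n k} (F : List (Hyperplane n)) →
  (∀ x → InGrid m x → x ≢ origin → k ≤ mult F x) → Punctured m k (divdiff F)
separately (divdiff-punctured F covers) = SepRecurrent-divdiff F
vanishes (divdiff-punctured {m} {n} {k} F covers) {σ} fits omits0 cost<k =
  SepRecurrent-vanish (SepRecurrent-divdiff F) at-point fits
  where
  in-grid : ∀ {n} {σ : Vec Shape n} (x ρ : Vec ℕ n) → Pointwise (Fits m) σ (confluent x ρ) → InGrid m x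
  in-grid (c ∷ x) (r ∷ ρ) (fit ∷ fits) zero    = proj₁ (fits-replicate fit)
  in-grid (c ∷ x) (r ∷ ρ) (fit ∷ fits) (suc i) = in-grid x ρ fits i

  sum≤cost : ∀ {n} {σ : Vec Shape n} (x ρ : Vec ℕ n) → Pointwise (Fits m) σ (confluent x ρ) → sum ρ ≤ cost σ
  sum≤cost []      []      []           = z≤n
  sum≤cost (c ∷ x) (r ∷ ρ) (fit ∷ fits) = ℕₚ.+-mono-≤ (proj₁ (proj₂ (fits-replicate fit))) (sum≤cost x ρ fits)

  ≢origin : ∀ {n} {σ : Vec Shape n} (x ρ : Vec ℕ n) → Pointwise (Fits m) σ (confluent x ρ) → Omits0 σ → x ≢ origin
  ≢origin (c ∷ x) (r ∷ ρ) (fit ∷ fits) (here p≡0)  eq = proj₂ (proj₂ (fits-replicate fit)) p≡0 (cong Vec.head eq)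
  ≢origin (c ∷ x) (r ∷ ρ) (fit ∷ fits) (there any) eq = ≢origin x ρ fits any (cong Vec.tail eq)

  at-point : ∀ x ρ → Pointwise (Fits m) σ (confluent x ρ) → divdiff F (confluent x ρ) ≡ 0ℚ
  at-point x ρ fits = divdiff-confluent F x ρ
    (ℕₚ.<-≤-trans (ℕₚ.≤-<-trans (sum≤cost x ρ fits) cost<k)
                  (covers x (in-grid x ρ fits) (≢origin x ρ fits omits0)))

-- Fixing a coordinate to a sublist of shape `s` uses up `order s` of the available vanishing order.
fix-first : ∀ {m k n L} {G : Nodes (suc n) → ℚ} s → Fits m s L →
  Punctured m (order s + k) G → Punctured m k (λ N → G (L ∷ N))
separately (fix-first s fit P) with separately P
... | _ ∷ sG = sG _
vanishes (fix-first s fit P) fits omits0 lt =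
  vanishes P {s ∷ _} (fit ∷ fits) (there omits0) (ℕₚ.+-monoʳ-< (order s) lt)

-- Removing the factor ∏ (x − c)

-- ∏_{c=1}^m (c − x) = α₀ m − α₁ m x + α₂ m x² − …
α₀ α₁ α₂ : ℕ → ℕ
α₀ zero    = 1
α₀ (suc m) = suc m * α₀ m
α₁ zero    = 0
α₁ (suc m) = suc m * α₁ m + α₀ m
α₂ zero    = 0
α₂ (suc m) = suc m * α₂ m + α₁ m

sgn : ℕ → ℚ
sgn zero    = 1ℚ
sgn (suc m) = ℚ.- sgn m

-- Reading g (0 ∷ L), g (0 ∷ 0 ∷ L), … as the coefficients of a power series S(L), this is
-- S(L) = ∏ (x − c) · S(positives m ++ L); it holds when g vanishes on lists without the node 0.
record Factors (g : List ℕ → ℚ) (m : ℕ) (L : List ℕ) : Set where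
  field
    coeff₀ : g (0 ∷ L) ≡ sgn m *ℚ (ℕ→ℚ (α₀ m) *ℚ g (0 ∷ positives m ++ L))
    coeff₁ : g (0 ∷ 0 ∷ L) ≡ sgn m *ℚ (ℕ→ℚ (α₀ m) *ℚ g (0 ∷ 0 ∷ positives m ++ L)
                                      -ℚ ℕ→ℚ (α₁ m) *ℚ g (0 ∷ positives m ++ L))
    coeff₂ : g (0 ∷ 0 ∷ 0 ∷ L) ≡ sgn m *ℚ (ℕ→ℚ (α₀ m) *ℚ g (0 ∷ 0 ∷ 0 ∷ positives m ++ L)
                                          -ℚ ℕ→ℚ (α₁ m) *ℚ g (0 ∷ 0 ∷ positives m ++ L)
                                          +ℚ ℕ→ℚ (α₂ m) *ℚ g (0 ∷ positives m ++ L))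
open Factors

-- The recurrence for the nodes 0 and c, read on coefficients as multiplication of the series by x -
-- c.
Recurrent-0∷ : ∀ {g} → Recurrent g → ∀ p c L →
  g (0 ∷ List.replicate p 0 ++ L) ≡ g (List.replicate p 0 ++ c ∷ L) -ℚ ℕ→ℚ c *ℚ g (0 ∷ List.replicate p 0 ++ c ∷ L)
Recurrent-0∷ {g} rg p c L = begin
  z                                    ≡⟨ solve 2 (λ y z → z := y :- (y :- z)) refl y z ⟩
  y -ℚ (y -ℚ z)                        ≡⟨ cong (y -ℚ_) (recurrence rg 0 (List.replicate p 0) c L) ⟨
  y -ℚ (ℕ→ℚ c -ℚ 0ℚ) *ℚ x              ≡⟨ solve 3 (λ c x y → y :- (c :- con 0ℚ) :* x := y :- c :* x) refl (ℕ→ℚ c) x y ⟩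
  y -ℚ ℕ→ℚ c *ℚ x                      ∎
  where
  open ≡-Reasoning
  x = g (0 ∷ List.replicate p 0 ++ c ∷ L)
  y = g (List.replicate p 0 ++ c ∷ L)
  z = g (0 ∷ List.replicate p 0 ++ L)

-- Induction on `m`, multiplying by one factor x - (m + 1) at a time. The hypothesis removes the
-- remainder, a value on nodes without 0, which would otherwise enter the constant coefficient.
factors : ∀ {g} → Recurrent g → ∀ m L → (∀ i → i < m → g (positives (suc i) ++ L) ≡ 0ℚ) → Factors g m L
factors {g} rg zero L _ = record
  { coeff₀ = solve 1 (λ x → x := con 1ℚ :* (con 1ℚ :* x)) refl (g (0 ∷ L))
  ; coeff₁ = solve 2 (λ x y → y := con 1ℚ :* (con 1ℚ :* y :- con 0ℚ :* x)) refl (g (0 ∷ L)) (g (0 ∷ 0 ∷ L))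
  ; coeff₂ = solve 3 (λ x y z → z := con 1ℚ :* (con 1ℚ :* z :- con 0ℚ :* y :+ con 0ℚ :* x)) refl
               (g (0 ∷ L)) (g (0 ∷ 0 ∷ L)) (g (0 ∷ 0 ∷ 0 ∷ L))
  }
factors {g} rg (suc m) L vanish = record
  { coeff₀ = begin
      g (0 ∷ L)
        ≡⟨ coeff₀ F ⟩
      s *ℚ (a₀ *ℚ g (0 ∷ M))
        ≡⟨ cong (λ w → s *ℚ (a₀ *ℚ w)) first ⟩
      s *ℚ (a₀ *ℚ (0ℚ -ℚ c *ℚ x))
        ≡⟨ solve 4 (λ s a₀ c x → s :* (a₀ :* (con 0ℚ :- c :* x)) := (:- s) :* (c :* a₀ :* x)) refl s a₀ c x ⟩
      (ℚ.- s) *ℚ (c *ℚ a₀ *ℚ x)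
        ≡⟨ cong (λ w → (ℚ.- s) *ℚ (w *ℚ x)) e₀ ⟨
      (ℚ.- s) *ℚ (ℕ→ℚ (α₀ (suc m)) *ℚ x) ∎
  ; coeff₁ = begin
      g (0 ∷ 0 ∷ L)
        ≡⟨ coeff₁ F ⟩
      s *ℚ (a₀ *ℚ g (0 ∷ 0 ∷ M) -ℚ a₁ *ℚ g (0 ∷ M))
        ≡⟨ cong₂ (λ w v → s *ℚ (a₀ *ℚ w -ℚ a₁ *ℚ v)) (Recurrent-0∷ rg 1 (suc m) M) first ⟩
      s *ℚ (a₀ *ℚ (x -ℚ c *ℚ y) -ℚ a₁ *ℚ (0ℚ -ℚ c *ℚ x))
        ≡⟨ solve 6 (λ s a₀ a₁ c x y →
             s :* (a₀ :* (x :- c :* y) :- a₁ :* (con 0ℚ :- c :* x)) :=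
             (:- s) :* (c :* a₀ :* y :- (c :* a₁ :+ a₀) :* x)) refl s a₀ a₁ c x y ⟩
      (ℚ.- s) *ℚ (c *ℚ a₀ *ℚ y -ℚ (c *ℚ a₁ +ℚ a₀) *ℚ x)
        ≡⟨ cong₂ (λ w v → (ℚ.- s) *ℚ (w *ℚ y -ℚ v *ℚ x)) e₀ e₁ ⟨
      (ℚ.- s) *ℚ (ℕ→ℚ (α₀ (suc m)) *ℚ y -ℚ ℕ→ℚ (α₁ (suc m)) *ℚ x) ∎
  ; coeff₂ = begin
      g (0 ∷ 0 ∷ 0 ∷ L)
        ≡⟨ coeff₂ F ⟩
      s *ℚ (a₀ *ℚ g (0 ∷ 0 ∷ 0 ∷ M) -ℚ a₁ *ℚ g (0 ∷ 0 ∷ M) +ℚ a₂ *ℚ g (0 ∷ M))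
        ≡⟨ cong₂ (λ u v → s *ℚ (a₀ *ℚ u -ℚ a₁ *ℚ g (0 ∷ 0 ∷ M) +ℚ a₂ *ℚ v)) (Recurrent-0∷ rg 2 (suc m) M) first ⟩
      s *ℚ (a₀ *ℚ (y -ℚ c *ℚ z) -ℚ a₁ *ℚ g (0 ∷ 0 ∷ M) +ℚ a₂ *ℚ (0ℚ -ℚ c *ℚ x))
        ≡⟨ cong (λ w → s *ℚ (a₀ *ℚ (y -ℚ c *ℚ z) -ℚ a₁ *ℚ w +ℚ a₂ *ℚ (0ℚ -ℚ c *ℚ x))) (Recurrent-0∷ rg 1 (suc m) M) ⟩
      s *ℚ (a₀ *ℚ (y -ℚ c *ℚ z) -ℚ a₁ *ℚ (x -ℚ c *ℚ y) +ℚ a₂ *ℚ (0ℚ -ℚ c *ℚ x))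
        ≡⟨ solve 8 (λ s a₀ a₁ a₂ c x y z →
             s :* (a₀ :* (y :- c :* z) :- a₁ :* (x :- c :* y) :+ a₂ :* (con 0ℚ :- c :* x)) :=
             (:- s) :* (c :* a₀ :* z :- (c :* a₁ :+ a₀) :* y :+ (c :* a₂ :+ a₁) :* x)) refl s a₀ a₁ a₂ c x y z ⟩
      (ℚ.- s) *ℚ (c *ℚ a₀ *ℚ z -ℚ (c *ℚ a₁ +ℚ a₀) *ℚ y +ℚ (c *ℚ a₂ +ℚ a₁) *ℚ x)
        ≡⟨ cong₂ (λ u v → (ℚ.- s) *ℚ (u *ℚ z -ℚ v *ℚ y +ℚ (c *ℚ a₂ +ℚ a₁) *ℚ x)) e₀ e₁ ⟨
      (ℚ.- s) *ℚ (ℕ→ℚ (α₀ (suc m)) *ℚ z -ℚ ℕ→ℚ (α₁ (suc m)) *ℚ y +ℚ (c *ℚ a₂ +ℚ a₁) *ℚ x)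
        ≡⟨ cong (λ w → (ℚ.- s) *ℚ (ℕ→ℚ (α₀ (suc m)) *ℚ z -ℚ ℕ→ℚ (α₁ (suc m)) *ℚ y +ℚ w *ℚ x)) e₂ ⟨
      (ℚ.- s) *ℚ (ℕ→ℚ (α₀ (suc m)) *ℚ z -ℚ ℕ→ℚ (α₁ (suc m)) *ℚ y +ℚ ℕ→ℚ (α₂ (suc m)) *ℚ x) ∎
  }
  where
  open ≡-Reasoning
  F = factors rg m L (λ i i<m → vanish i (ℕₚ.m<n⇒m<1+n i<m))
  M = positives m ++ L
  s = sgn m
  a₀ = ℕ→ℚ (α₀ m)
  a₁ = ℕ→ℚ (α₁ m)
  a₂ = ℕ→ℚ (α₂ m)
  c = ℕ→ℚ (suc m)
  x = g (0 ∷ suc m ∷ M)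
  y = g (0 ∷ 0 ∷ suc m ∷ M)
  z = g (0 ∷ 0 ∷ 0 ∷ suc m ∷ M)
  e₀ : ℕ→ℚ (α₀ (suc m)) ≡ c *ℚ a₀
  e₀ = ℕ→ℚ-* (suc m) (α₀ m)
  e₁ : ℕ→ℚ (α₁ (suc m)) ≡ c *ℚ a₁ +ℚ a₀
  e₁ = trans (ℕ→ℚ-+ (suc m * α₁ m) (α₀ m)) (cong (_+ℚ a₀) (ℕ→ℚ-* (suc m) (α₁ m)))
  e₂ : ℕ→ℚ (α₂ (suc m)) ≡ c *ℚ a₂ +ℚ a₁
  e₂ = trans (ℕ→ℚ-+ (suc m * α₂ m) (α₁ m)) (cong (_+ℚ a₁) (ℕ→ℚ-* (suc m) (α₂ m)))
  first : g (0 ∷ M) ≡ 0ℚ -ℚ c *ℚ x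
  first = trans (Recurrent-0∷ rg 0 (suc m) M) (cong (_-ℚ c *ℚ x) (vanish m (ℕₚ.n<1+n m)))

-- Positivity and log-concavity of the coefficients

α₀>0 : ∀ m → 0 < α₀ m
α₀>0 zero    = z<s
α₀>0 (suc m) = ℕₚ.<-≤-trans (α₀>0 m) (ℕₚ.m≤m+n (α₀ m) _)

α₁>0 : ∀ {m} → 1 ≤ m → 0 < α₁ m
α₁>0 {suc m} _ = ℕₚ.<-≤-trans (α₀>0 m) (ℕₚ.m≤n+m (α₀ m) _)

-- A weak form of Newton's inequality for a real-rooted polynomial; a new root c only adds the slack
-- c α₀ α₁ + α₀².
α₀α₂≤α₁² : ∀ m → α₀ m * α₂ m ≤ α₁ m * α₁ m
α₀α₂≤α₁² zero    = z≤n
α₀α₂≤α₁² (suc m) = begin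
  (c * a₀) * (c * a₂ + a₁)
    ≡⟨ expandˡ c a₀ a₁ a₂ ⟩
  c * c * (a₀ * a₂) + c * a₀ * a₁
    ≤⟨ ℕₚ.+-monoˡ-≤ (c * a₀ * a₁) (ℕₚ.*-monoʳ-≤ (c * c) (α₀α₂≤α₁² m)) ⟩
  c * c * (a₁ * a₁) + c * a₀ * a₁
    ≤⟨ ℕₚ.m≤m+n _ _ ⟩
  c * c * (a₁ * a₁) + c * a₀ * a₁ + (c * a₀ * a₁ + a₀ * a₀)
    ≡⟨ expandʳ c a₀ a₁ ⟩
  (c * a₁ + a₀) * (c * a₁ + a₀) ∎
  where
  open ℕₚ.≤-Reasoning
  c  = suc m
  a₀ = α₀ m
  a₁ = α₁ m
  a₂ = α₂ m
  expandˡ : ∀ c a₀ a₁ a₂ → (c * a₀) * (c * a₂ + a₁) ≡ c * c * (a₀ * a₂) + c * a₀ * a₁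
  expandˡ = solve-∀
  expandʳ : ∀ c a₀ a₁ → c * c * (a₁ * a₁) + c * a₀ * a₁ + (c * a₀ * a₁ + a₀ * a₀) ≡ (c * a₁ + a₀) * (c * a₁ + a₀)
  expandʳ = solve-∀

sgn≢0 : ∀ m → sgn m ≢ 0ℚ
sgn≢0 zero    ()
sgn≢0 (suc m) eq = sgn≢0 m (ℚₚ.neg-injective eq)

a₀≢0 : ∀ m → ℕ→ℚ (α₀ m) ≢ 0ℚ
a₀≢0 m = ℕ→ℚ≢0 (ℕₚ.m<n⇒n≢0 (α₀>0 m))

a₁≢0 : ∀ {m} → 1 ≤ m → ℕ→ℚ (α₁ m) ≢ 0ℚ
a₁≢0 1≤m = ℕ→ℚ≢0 (ℕₚ.m<n⇒n≢0 (α₁>0 1≤m))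

-- Consequences of vanishing coefficients

factors-down : ∀ {g m L} → Factors g m L → g (0 ∷ positives m ++ L) ≡ 0ℚ → g (0 ∷ L) ≡ 0ℚ
factors-down {g} {m} F eq = trans (coeff₀ F) (trans (cong (λ w → sgn m *ℚ (ℕ→ℚ (α₀ m) *ℚ w)) eq)
  (solve 2 (λ s a → s :* (a :* con 0ℚ) := con 0ℚ) refl (sgn m) (ℕ→ℚ (α₀ m))))

-- With both linear coefficients zero, `coeff₁` reduces to α₁ times the constant coefficient, and α₁
-- is nonzero because m ≥ 1.
factors-first-order : ∀ {g m L} → 1 ≤ m → Factors g m L →
  g (0 ∷ 0 ∷ L) ≡ 0ℚ → g (0 ∷ 0 ∷ positives m ++ L) ≡ 0ℚ → g (0 ∷ positives m ++ L) ≡ 0ℚ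
factors-first-order {g} {m} {L} 1≤m F eq₁ eq₂ = *-zero-divisorˡ (a₁≢0 1≤m) (*-zero-divisorˡ (sgn≢0 m) (begin
  s *ℚ (a₁ *ℚ x)                          ≡⟨ solve 4 (λ s a₀ a₁ x → s :* (a₁ :* x) := :- (s :* (a₀ :* con 0ℚ :- a₁ :* x))) refl s a₀ a₁ x ⟩
  ℚ.- (s *ℚ (a₀ *ℚ 0ℚ -ℚ a₁ *ℚ x))        ≡⟨ cong (λ w → ℚ.- (s *ℚ (a₀ *ℚ w -ℚ a₁ *ℚ x))) eq₂ ⟨
  ℚ.- (s *ℚ (a₀ *ℚ y -ℚ a₁ *ℚ x))         ≡⟨ cong ℚ.-_ (trans (sym (coeff₁ F)) eq₁) ⟩
  0ℚ                                      ∎))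
  where
  open ≡-Reasoning
  s  = sgn m
  a₀ = ℕ→ℚ (α₀ m)
  a₁ = ℕ→ℚ (α₁ m)
  x = g (0 ∷ positives m ++ L)
  y = g (0 ∷ 0 ∷ positives m ++ L)

-- For u = g (0 ∷ L₂), v = g (0 ∷ 0 ∷ L₂) the hypotheses say a₀ v = 2 a₁ u and a₁ v = a₂ u,
-- so (2 a₁² − a₀ a₂) u = 0.
factors-second-order : ∀ {g m L} → let L₁ = positives m ++ L; L₂ = positives m ++ L₁ in 1 ≤ m →
  Factors g m L → Factors g m L₁ →
  g (0 ∷ 0 ∷ L) ≡ 0ℚ → g (0 ∷ 0 ∷ 0 ∷ L₁) ≡ 0ℚ → g (0 ∷ 0 ∷ 0 ∷ L₂) ≡ 0ℚ → g (0 ∷ L₂) ≡ 0ℚ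
factors-second-order {g} {m} {L} 1≤m F F₁ eq eq₁ eq₂ =
  *-zero-divisorˡ (ℕ→ℚ≢0 (ℕₚ.m<n⇒n≢0 (ℕₚ.m<n⇒0<n∸m gap))) (begin
    ℕ→ℚ D *ℚ u
      ≡⟨ solve 3 (λ d e u → d :* u := (d :+ e) :* u :- e :* u) refl (ℕ→ℚ D) (a₀ *ℚ a₂) u ⟩
    (ℕ→ℚ D +ℚ a₀ *ℚ a₂) *ℚ u -ℚ a₀ *ℚ a₂ *ℚ u
      ≡⟨ cong (λ w → w *ℚ u -ℚ a₀ *ℚ a₂ *ℚ u) D+ ⟩
    (a₁ *ℚ a₁ +ℚ a₁ *ℚ a₁) *ℚ u -ℚ a₀ *ℚ a₂ *ℚ u
      ≡⟨ solve 5 (λ a₀ a₁ a₂ u v →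
           (a₁ :* a₁ :+ a₁ :* a₁) :* u :- a₀ :* a₂ :* u :=
           :- (a₁ :* (a₀ :* v :- a₁ :* u :- a₁ :* u)) :- a₀ :* (a₀ :* con 0ℚ :- a₁ :* v :+ a₂ :* u)) refl a₀ a₁ a₂ u v ⟩
    ℚ.- (a₁ *ℚ (a₀ *ℚ v -ℚ a₁ *ℚ u -ℚ a₁ *ℚ u)) -ℚ a₀ *ℚ (a₀ *ℚ 0ℚ -ℚ a₁ *ℚ v +ℚ a₂ *ℚ u)
      ≡⟨ cong₂ (λ y z → ℚ.- (a₁ *ℚ y) -ℚ a₀ *ℚ z) rel₁ rel₂ ⟩
    ℚ.- (a₁ *ℚ 0ℚ) -ℚ a₀ *ℚ 0ℚ
      ≡⟨ solve 2 (λ a₀ a₁ → :- (a₁ :* con 0ℚ) :- a₀ :* con 0ℚ := con 0ℚ) refl a₀ a₁ ⟩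
    0ℚ ∎)
  where
  open ≡-Reasoning
  L₁ = positives m ++ L
  L₂ = positives m ++ L₁
  s  = sgn m
  a₀ = ℕ→ℚ (α₀ m)
  a₁ = ℕ→ℚ (α₁ m)
  a₂ = ℕ→ℚ (α₂ m)
  u = g (0 ∷ L₂)
  v = g (0 ∷ 0 ∷ L₂)
  sq = α₁ m * α₁ m
  -- By `gap` the truncated subtraction is exact and its result positive.
  D = (sq + sq) ∸ α₀ m * α₂ m
  gap : α₀ m * α₂ m < sq + sq
  gap = ℕₚ.≤-<-trans (α₀α₂≤α₁² m) (ℕₚ.m<m+n sq (ℕₚ.*-mono-< (α₁>0 1≤m) (α₁>0 1≤m)))
  D+ : ℕ→ℚ D +ℚ a₀ *ℚ a₂ ≡ a₁ *ℚ a₁ +ℚ a₁ *ℚ a₁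
  D+ = begin
    ℕ→ℚ D +ℚ a₀ *ℚ a₂              ≡⟨ cong (ℕ→ℚ D +ℚ_) (ℕ→ℚ-* (α₀ m) (α₂ m)) ⟨
    ℕ→ℚ D +ℚ ℕ→ℚ (α₀ m * α₂ m)     ≡⟨ ℕ→ℚ-+ D (α₀ m * α₂ m) ⟨
    ℕ→ℚ (D + α₀ m * α₂ m)          ≡⟨ cong ℕ→ℚ (ℕₚ.m∸n+n≡m (ℕₚ.<⇒≤ gap)) ⟩
    ℕ→ℚ (sq + sq)                  ≡⟨ ℕ→ℚ-+ sq sq ⟩
    ℕ→ℚ sq +ℚ ℕ→ℚ sq               ≡⟨ cong₂ _+ℚ_ (ℕ→ℚ-* (α₁ m) (α₁ m)) (ℕ→ℚ-* (α₁ m) (α₁ m)) ⟩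
    a₁ *ℚ a₁ +ℚ a₁ *ℚ a₁           ∎
  -- This is `coeff₁ F` with both of its terms expanded by `F₁`, that is, the linear coefficient
  -- after two multiplications by the product.
  rel₁ : a₀ *ℚ v -ℚ a₁ *ℚ u -ℚ a₁ *ℚ u ≡ 0ℚ
  rel₁ = *-zero-divisorˡ (a₀≢0 m) (*-zero-divisorˡ (sgn≢0 m) (*-zero-divisorˡ (sgn≢0 m) (begin
    s *ℚ (s *ℚ (a₀ *ℚ (a₀ *ℚ v -ℚ a₁ *ℚ u -ℚ a₁ *ℚ u)))
      ≡⟨ solve 5 (λ s a₀ a₁ u v →
           s :* (s :* (a₀ :* (a₀ :* v :- a₁ :* u :- a₁ :* u))) :=
           s :* (a₀ :* (s :* (a₀ :* v :- a₁ :* u)) :- a₁ :* (s :* (a₀ :* u)))) refl s a₀ a₁ u v ⟩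
    s *ℚ (a₀ *ℚ (s *ℚ (a₀ *ℚ v -ℚ a₁ *ℚ u)) -ℚ a₁ *ℚ (s *ℚ (a₀ *ℚ u)))
      ≡⟨ cong₂ (λ y z → s *ℚ (a₀ *ℚ y -ℚ a₁ *ℚ z)) (coeff₁ F₁) (coeff₀ F₁) ⟨
    s *ℚ (a₀ *ℚ g (0 ∷ 0 ∷ L₁) -ℚ a₁ *ℚ g (0 ∷ L₁))
      ≡⟨ trans (sym (coeff₁ F)) eq ⟩
    0ℚ ∎)))
  rel₂ : a₀ *ℚ 0ℚ -ℚ a₁ *ℚ v +ℚ a₂ *ℚ u ≡ 0ℚ
  rel₂ = *-zero-divisorˡ (sgn≢0 m) (begin
    s *ℚ (a₀ *ℚ 0ℚ -ℚ a₁ *ℚ v +ℚ a₂ *ℚ u)                      ≡⟨ cong (λ w → s *ℚ (a₀ *ℚ w -ℚ a₁ *ℚ v +ℚ a₂ *ℚ u)) eq₂ ⟨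
    s *ℚ (a₀ *ℚ g (0 ∷ 0 ∷ 0 ∷ L₂) -ℚ a₁ *ℚ v +ℚ a₂ *ℚ u)      ≡⟨ trans (sym (coeff₂ F₁)) eq₁ ⟩
    0ℚ                                                         ∎)

-- Lower bounds

-- The remainders in `factors` fit the shape (0 , b + 1), which omits the origin and has order b.
-- Thus raising the multiplicity from b to b + 1 requires b + `cost τ` < k.
punctured-factors : ∀ {m k n} {G : Nodes (suc n) → ℚ} → Punctured m k G →
  ∀ {τ : Vec Shape n} {N} → Pointwise (Fits m) τ N → ∀ b → b + cost τ < k →
  Factors (λ L → G (L ∷ N)) m (copies m b)
punctured-factors {m} {G = G} P {τ} {N} fits b lt = factors rec m (copies m b) λ i i<m →
  vanishes P {(0 , suc b) ∷ τ} (((λ ()) , bound i<m) ∷ fits) (here refl) lt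
  where
  rec : Recurrent (λ L → G (L ∷ N))
  rec with separately P
  ... | rG ∷ _ = rG N

  bound : ∀ {i} → i < m → ∀ c → count c (positives (suc i) ++ copies m b) ≤ count c (positives m ++ copies m b)
  bound {i} i<m c = subst₂ _≤_ (sym (count-++ c (positives (suc i)) _)) (sym (count-++ c (positives m) _))
    (ℕₚ.+-monoˡ-≤ (count c (copies m b)) (count-positives-mono c i<m))

tensor : ∀ {n} → ℕ → Vec Shape n → Nodes n
tensor m = mapᵛ (nodes m)

fits-nodes : ∀ {m p b} → Fits m (suc p , b) (nodes m (suc p , b))
fits-nodes = (λ ()) , λ c → ℕₚ.≤-refl

fits-tensor : ∀ m b n → Pointwise (Fits m) (replicateᵛ n (1 , b)) (tensor m (replicateᵛ n (1 , b)))
fits-tensor m b zero    = []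
fits-tensor m b (suc n) = fits-nodes ∷ fits-tensor m b n

simple-cost : ∀ n b → b ≤ 1 → cost (replicateᵛ n (1 , b)) ≡ 0
simple-cost zero    b             _ = refl
simple-cost (suc n) zero          l = simple-cost n zero l
simple-cost (suc n) (suc zero)    l = simple-cost n 1 l
simple-cost (suc n) (suc (suc b)) (s≤s ())

-- The nodes 1,...,m are stripped from one coordinate after another. All shapes involved have order
-- 0, so a positive vanishing order suffices.
origin-from-grid : ∀ {m k n} {G : Nodes n → ℚ} → Punctured m (suc k) G →
  G (tensor m (replicateᵛ n (1 , 1))) ≡ 0ℚ → G (tensor m (replicateᵛ n (1 , 0))) ≡ 0ℚ
origin-from-grid {n = zero}  P eq = eq
origin-from-grid {m} {k} {suc n} {G} P eq =
  factors-down (punctured-factors P (fits-tensor m 0 n) 0 (subst (_< suc k) (sym (simple-cost n 0 z≤n)) z<s))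
    (origin-from-grid (fix-first (1 , 1) fits-nodes P) eq)

module _ {m n : ℕ} where

  private
    rest : Vec Shape n
    rest = replicateᵛ n (1 , 1)

    fits-rest : Pointwise (Fits m) rest (tensor m rest)
    fits-rest = fits-tensor m 1 n

    fits-simple : Fits m (1 , 1) (nodes m (1 , 1))
    fits-simple = fits-nodes

    budget : ∀ {k} b → b < k → b + cost rest < k
    budget {k} b b<k = subst (_< k) (sym (trans (cong (b +_) (simple-cost n 1 ℕₚ.≤-refl)) (ℕₚ.+-identityʳ b))) b<k

  grid-vanish₂ : {G : Nodes (1 + n) → ℚ} → Punctured m 2 G →
    G (tensor m ((1 , 2) ∷ rest)) ≡ 0ℚ →
    G (tensor m ((1 , 1) ∷ rest)) ≡ 0ℚ
  grid-vanish₂ P = factors-down (punctured-factors P fits-rest 1 (budget 1 ℕₚ.≤-refl))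

  grid-vanish₃ : {G : Nodes (2 + n) → ℚ} → 1 ≤ m → Punctured m 3 G →
    G (tensor m ((2 , 3) ∷ (1 , 1) ∷ rest)) ≡ 0ℚ →
    G (tensor m ((2 , 2) ∷ (1 , 2) ∷ rest)) ≡ 0ℚ →
    G (tensor m ((1 , 1) ∷ (1 , 1) ∷ rest)) ≡ 0ℚ
  grid-vanish₃ {G} 1≤m P q2311 q2212 = factors-down (F 1 (s<s z<s)) (factors-down (F 2 ℕₚ.≤-refl) q1311)
    where
    F : ∀ b → b < 3 → Factors (λ L → G (L ∷ tensor m ((1 , 1) ∷ rest))) m (copies m b)
    F b b<3 = punctured-factors P (fits-simple ∷ fits-rest) b (budget b b<3)

    q2211 : G (tensor m ((2 , 2) ∷ (1 , 1) ∷ rest)) ≡ 0ℚ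
    -- Fixing (2 , 2) costs one order; the remaining two permit lowering (1 , 2) to (1 , 1) in the
    -- next coordinate.
    q2211 = factors-down (punctured-factors (fix-first (2 , 2) fits-nodes P) fits-rest 1 (budget 1 ℕₚ.≤-refl)) q2212

    -- The linear coefficients now vanish for b = 2 and b = 3, which forces the constant one to
    -- vanish for b = 3.
    q1311 : G (tensor m ((1 , 3) ∷ (1 , 1) ∷ rest)) ≡ 0ℚ
    q1311 = factors-first-order 1≤m (F 2 ℕₚ.≤-refl) q2211 q2311

  grid-vanish₄ : {G : Nodes (3 + n) → ℚ} → 1 ≤ m → Punctured m 4 G →
    G (tensor m ((2 , 2) ∷ (2 , 2) ∷ (1 , 2) ∷ rest)) ≡ 0ℚ →
    G (tensor m ((2 , 2) ∷ (2 , 3) ∷ (1 , 1) ∷ rest)) ≡ 0ℚ →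
    G (tensor m ((3 , 3) ∷ (1 , 2) ∷ (1 , 1) ∷ rest)) ≡ 0ℚ →
    G (tensor m ((3 , 4) ∷ (1 , 1) ∷ (1 , 1) ∷ rest)) ≡ 0ℚ →
    G (tensor m ((1 , 1) ∷ (1 , 1) ∷ (1 , 1) ∷ rest)) ≡ 0ℚ
  grid-vanish₄ {G} 1≤m P q222212 q222311 q331211 q341111 =
    factors-down (F 1 (s<s z<s)) (factors-down (F 2 (s<s (s<s z<s))) (factors-down (F 3 ℕₚ.≤-refl) q141111))
    where
    F : ∀ b → b < 4 → Factors (λ L → G (L ∷ tensor m ((1 , 1) ∷ (1 , 1) ∷ rest))) m (copies m b)
    F b b<4 = punctured-factors P (fits-simple ∷ fits-simple ∷ fits-rest) b (budget b b<4)

    -- With the first coordinate fixed to (2 , 2), the argument of `grid-vanish₃` is repeated on the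
    -- other coordinates.
    P₂₂ : Punctured m 3 (λ N → G (nodes m (2 , 2) ∷ N))
    P₂₂ = fix-first (2 , 2) fits-nodes P

    F₂₂ : Factors (λ L → G (nodes m (2 , 2) ∷ L ∷ tensor m ((1 , 1) ∷ rest))) m (copies m 2)
    F₂₂ = punctured-factors P₂₂ (fits-simple ∷ fits-rest) 2 (budget 2 ℕₚ.≤-refl)

    q222211 : G (tensor m ((2 , 2) ∷ (2 , 2) ∷ (1 , 1) ∷ rest)) ≡ 0ℚ
    q222211 = factors-down
      (punctured-factors (fix-first (2 , 2) fits-nodes P₂₂) fits-rest 1 (budget 1 ℕₚ.≤-refl)) q222212

    q221311 : G (tensor m ((2 , 2) ∷ (1 , 3) ∷ (1 , 1) ∷ rest)) ≡ 0ℚ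
    q221311 = factors-first-order 1≤m F₂₂ q222211 q222311

    q221111 : G (tensor m ((2 , 2) ∷ (1 , 1) ∷ (1 , 1) ∷ rest)) ≡ 0ℚ
    q221111 = factors-down (punctured-factors P₂₂ (fits-simple ∷ fits-rest) 1 (budget 1 (s<s z<s))) (factors-down F₂₂ q221311)

    q331111 : G (tensor m ((3 , 3) ∷ (1 , 1) ∷ (1 , 1) ∷ rest)) ≡ 0ℚ
    q331111 = factors-down
      (punctured-factors (fix-first (3 , 3) fits-nodes P) (fits-simple ∷ fits-rest) 1 (budget 1 ℕₚ.≤-refl)) q331211

    q141111 : G (tensor m ((1 , 4) ∷ (1 , 1) ∷ (1 , 1) ∷ rest)) ≡ 0ℚ
    -- The inputs are the linear coefficient for b = 2 and the quadratic coefficients for b = 3 and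
    -- b = 4.
    q141111 = factors-second-order 1≤m (F 2 (s<s (s<s z<s))) (F 3 ℕₚ.≤-refl) q221111 q331111 q341111

-- Total orders of the chosen tensors

length-nodes : ∀ m p b → length (nodes m (p , b)) ≡ p + b * m
length-nodes m p b = begin
  length (List.replicate p 0 ++ copies m b)             ≡⟨ Listₚ.length-++ (List.replicate p 0) ⟩
  length (List.replicate p 0) + length (copies m b)     ≡⟨ cong₂ _+_ (Listₚ.length-replicate p) (length-copies b) ⟩
  p + b * m                                             ∎
  where
  open ≡-Reasoning
  length-positives : ∀ m → length (positives m) ≡ m
  length-positives zero    = refl
  length-positives (suc m) = cong suc (length-positives m)

  length-copies : ∀ b → length (copies m b) ≡ b * m
  length-copies zero    = refl
  length-copies (suc b) = trans (Listₚ.length-++ (positives m)) (cong₂ _+_ (length-positives m) (length-copies b))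

total : ∀ {n} → ℕ → Vec Shape n → ℕ
total m []            = 0
total m ((p , b) ∷ σ) = p + b * m + total m σ

size-tensor : ∀ {j} m (σ : Vec Shape j) n → size (tensor m (σ Vec.++ replicateᵛ n (1 , 1))) ≡ total m σ + n * suc m
size-tensor m [] zero    = refl
size-tensor m [] (suc n) = cong₂ _+_ (trans (length-nodes m 1 1) (cong suc (ℕₚ.+-identityʳ m))) (size-tensor m [] n)
size-tensor m ((p , b) ∷ σ) n = trans (cong₂ _+_ (length-nodes m p b) (size-tensor m σ n)) (sym (ℕₚ.+-assoc (p + b * m) _ _))

-- Here `t` is the number of nodes minus the number of coordinates, the total order of the divided
-- difference, so products of fewer than `t` forms are annihilated.
divdiff-tensor : ∀ {j m n t} (σ : Vec Shape j) (F : List (Hyperplane (j + n))) → length F < t →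
  t + (j + n) ≡ total m σ + n * suc m → divdiff F (tensor m (σ Vec.++ replicateᵛ n (1 , 1))) ≡ 0ℚ
divdiff-tensor {j} {m} {n} σ F lt eq =
  divdiff-degree F _ (subst (length F + (j + n) <_) (trans eq (sym (size-tensor m σ n))) (ℕₚ.+-monoˡ-< (j + n) lt))

divdiff-grid≢0 : ∀ {m n k} (F : List (Hyperplane n)) → Valid m n (suc k) F → divdiff F (tensor m (replicateᵛ n (1 , 1))) ≢ 0ℚ
divdiff-grid≢0 {m} {n} F (covers , avoids) eq = divdiff-origin F avoids
  (subst (λ N → divdiff F N ≡ 0ℚ) (Vecₚ.map-replicate (nodes m) (1 , 0) n)
    (origin-from-grid (divdiff-punctured F covers) eq))

lower-bound₂ : ∀ m n (F : List (Hyperplane (1 + n))) → Valid m (1 + n) 2 F → m * (1 + n) + m ≤ length F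
lower-bound₂ m n F valid@(covers , _) = ℕₚ.≮⇒≥ λ short → divdiff-grid≢0 F valid
  (grid-vanish₂ (divdiff-punctured F covers) (divdiff-tensor ((1 , 2) ∷ []) F short (degree m n)))
  where
  degree : ∀ m n → m * (1 + n) + m + (1 + n) ≡ 1 + 2 * m + 0 + n * suc m
  degree = solve-∀

-- Both tensors have total order equal to the claimed bound, so a shorter family makes both values
-- vanish.
lower-bound₃ : ∀ m n → 1 ≤ m → (F : List (Hyperplane (2 + n))) → Valid m (2 + n) 3 F →
  m * (2 + n) + (m + 1) * 2 ∸ 1 ≤ length F
lower-bound₃ m n 1≤m F valid@(covers , _) = ℕₚ.≮⇒≥ λ short →
  let short′ = subst (length F <_) (cong (_∸ 1) (shift m n)) short in
  divdiff-grid≢0 F valid (grid-vanish₃ 1≤m (divdiff-punctured F covers)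
    (divdiff-tensor ((2 , 3) ∷ (1 , 1) ∷ []) F short′ (degree₁ m n))
    (divdiff-tensor ((2 , 2) ∷ (1 , 2) ∷ []) F short′ (degree₂ m n)))
  where
  shift : ∀ m n → m * (2 + n) + (m + 1) * 2 ≡ 1 + (m * (2 + n) + (1 + 2 * m))
  shift = solve-∀
  degree₁ : ∀ m n → m * (2 + n) + (1 + 2 * m) + (2 + n) ≡ 2 + 3 * m + (1 + 1 * m + 0) + n * suc m
  degree₁ = solve-∀
  degree₂ : ∀ m n → m * (2 + n) + (1 + 2 * m) + (2 + n) ≡ 2 + 2 * m + (1 + 2 * m + 0) + n * suc m
  degree₂ = solve-∀

lower-bound₄ : ∀ m n → 1 ≤ m → (F : List (Hyperplane (3 + n))) → Valid m (3 + n) 4 F →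
  m * (3 + n) + (m + 1) * 3 ∸ 1 ≤ length F
lower-bound₄ m n 1≤m F valid@(covers , _) = ℕₚ.≮⇒≥ λ short →
  -- Exposing a successor turns the truncated `∸ 1` of the bound into an exact value, which is the
  -- total order of each of the four tensors.
  let short′ = subst (length F <_) (cong (_∸ 1) (shift m n)) short in
  divdiff-grid≢0 F valid (grid-vanish₄ 1≤m (divdiff-punctured F covers)
    (divdiff-tensor ((2 , 2) ∷ (2 , 2) ∷ (1 , 2) ∷ []) F short′ (degree₁ m n))
    (divdiff-tensor ((2 , 2) ∷ (2 , 3) ∷ (1 , 1) ∷ []) F short′ (degree₂ m n))
    (divdiff-tensor ((3 , 3) ∷ (1 , 2) ∷ (1 , 1) ∷ []) F short′ (degree₃ m n))
    (divdiff-tensor ((3 , 4) ∷ (1 , 1) ∷ (1 , 1) ∷ []) F short′ (degree₄ m n)))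
  where
  shift : ∀ m n → m * (3 + n) + (m + 1) * 3 ≡ 1 + (m * (3 + n) + (2 + 3 * m))
  shift = solve-∀
  degree₁ : ∀ m n → m * (3 + n) + (2 + 3 * m) + (3 + n) ≡ 2 + 2 * m + (2 + 2 * m + (1 + 2 * m + 0)) + n * suc m
  degree₁ = solve-∀
  degree₂ : ∀ m n → m * (3 + n) + (2 + 3 * m) + (3 + n) ≡ 2 + 2 * m + (2 + 3 * m + (1 + 1 * m + 0)) + n * suc m
  degree₂ = solve-∀
  degree₃ : ∀ m n → m * (3 + n) + (2 + 3 * m) + (3 + n) ≡ 3 + 3 * m + (1 + 2 * m + (1 + 1 * m + 0)) + n * suc m
  degree₃ = solve-∀
  degree₄ : ∀ m n → m * (3 + n) + (2 + 3 * m) + (3 + n) ≡ 3 + 4 * m + (1 + 1 * m + (1 + 1 * m + 0)) + n * suc m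
  degree₄ = solve-∀

-- The covering family

mult-++ : ∀ {n} (F F′ : List (Hyperplane n)) x → mult (F ++ F′) x ≡ mult F x + mult F′ x
mult-++ []      F′ x = refl
mult-++ (H ∷ F) F′ x with does (dot (normal H) x ℚ.≟ offset H)
... | true  = cong suc (mult-++ F F′ x)
... | false = mult-++ F F′ x

mult-∈H : ∀ {n} {x : Vec ℕ n} H F → x ∈H H → 1 ≤ mult (H ∷ F) x
mult-∈H {x = x} H F x∈H with dot (normal H) x ℚ.≟ offset H
... | yes _   = z<s
... | no  x∉H = contradiction x∈H x∉H

mult-∷ : ∀ {n} (x : Vec ℕ n) H F → mult F x ≤ mult (H ∷ F) x
mult-∷ x H F with does (dot (normal H) x ℚ.≟ offset H)
... | true  = ℕₚ.n≤1+n _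
... | false = ℕₚ.≤-refl

dot-origin : ∀ {n} (as : Vec ℚ n) → dot as origin ≡ 0ℚ
dot-origin []       = refl
dot-origin (a ∷ as) = cong₂ _+ℚ_ (ℚₚ.*-zeroʳ a) (dot-origin as)

-- A linear form is 0 at the origin, so a nonzero offset means that the plane misses it.
Off0 : ∀ {n} → List (Hyperplane n) → Set
Off0 = All (λ H → offset H ≢ 0ℚ)

mult-origin : ∀ {n} {F : List (Hyperplane n)} → Off0 F → mult F origin ≡ 0
mult-origin []            = refl
mult-origin {F = H ∷ F} (off ∷ offs) with dot (normal H) origin ℚ.≟ offset H
... | yes eq = contradiction (trans (sym eq) (dot-origin (normal H))) off
... | no  _  = mult-origin offs

dot-ones : ∀ {n} (x : Vec ℕ n) → dot (replicateᵛ n 1ℚ) x ≡ ℕ→ℚ (sum x)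
dot-ones []      = refl
dot-ones (c ∷ x) = trans (cong₂ _+ℚ_ (ℚₚ.*-identityˡ (ℕ→ℚ c)) (dot-ones x)) (sym (ℕ→ℚ-+ c (sum x)))

dot-zeros : ∀ {n} (x : Vec ℕ n) → dot (replicateᵛ n 0ℚ) x ≡ 0ℚ
dot-zeros []      = refl
dot-zeros (c ∷ x) = cong₂ _+ℚ_ (ℚₚ.*-zeroˡ (ℕ→ℚ c)) (dot-zeros x)

sum-plane : ∀ n → ℕ → Hyperplane (suc n)
sum-plane n j = record { normal = replicateᵛ (suc n) 1ℚ ; offset = ℕ→ℚ j ; nonzero = zero , λ () }

first-plane : ∀ n → ℕ → Hyperplane (suc n)
first-plane n j = record { normal = 1ℚ ∷ replicateᵛ n 0ℚ ; offset = ℕ→ℚ j ; nonzero = zero , λ () }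

parallel : ∀ {n} → (ℕ → Hyperplane n) → ℕ → List (Hyperplane n)
parallel plane m = List.map plane (positives m)

parallel-covers : ∀ {n x} (plane : ℕ → Hyperplane n) {j} m → x ∈H plane j → 0 < j → j ≤ m → 1 ≤ mult (parallel plane m) x
parallel-covers plane zero x∈ 0<j j≤0 = contradiction (ℕₚ.<-≤-trans 0<j j≤0) λ ()
parallel-covers {x = x} plane (suc m) x∈ 0<j j≤m with ℕₚ.m≤n⇒m<n∨m≡n j≤m
... | inj₁ j<m  = ℕₚ.≤-trans (parallel-covers plane m x∈ 0<j (s≤s⁻¹ j<m)) (mult-∷ x (plane (suc m)) (parallel plane m))
... | inj₂ refl = mult-∈H (plane (suc m)) (parallel plane m) x∈

length-parallel : ∀ {n} (plane : ℕ → Hyperplane n) m → length (parallel plane m) ≡ m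
length-parallel plane zero    = refl
length-parallel plane (suc m) = cong suc (length-parallel plane m)

parallel-off0 : ∀ {n} {plane : ℕ → Hyperplane n} → (∀ j → offset (plane j) ≡ ℕ→ℚ j) → ∀ m → Off0 (parallel plane m)
parallel-off0 off zero    = []
parallel-off0 off (suc m) = (λ eq → ℕ→ℚ≢0 {suc m} (λ ()) (trans (sym (off (suc m))) eq)) ∷ parallel-off0 off m

lift : ∀ {n} → Hyperplane n → Hyperplane (suc n)
lift H = record { normal = 0ℚ ∷ normal H ; offset = offset H ; nonzero = suc (proj₁ (nonzero H)) , proj₂ (nonzero H) }

mult-lift : ∀ {n} (F : List (Hyperplane n)) c x → mult (List.map lift F) (c ∷ x) ≡ mult F x
mult-lift []      c x = refl
mult-lift (H ∷ F) c x
  rewrite ℚₚ.*-zeroˡ (ℕ→ℚ c) | ℚₚ.+-identityˡ (dot (normal H) x) | mult-lift F c x = refl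

axes : ℕ → ∀ n → List (Hyperplane n)
axes m zero    = []
axes m (suc n) = parallel (first-plane n) m ++ List.map lift (axes m n)

support : ∀ {n} → Vec ℕ n → ℕ
support []          = 0
support (zero ∷ x)  = support x
support (suc c ∷ x) = suc (support x)

-- Each nonzero coordinate xᵢ = c contributes the plane xᵢ = c.
axes-cover : ∀ {n} m (x : Vec ℕ n) → InGrid m x → support x ≤ mult (axes m n) x
axes-cover m []      _  = z≤n
axes-cover {suc n} m (c ∷ x) x≤m =
  subst (support (c ∷ x) ≤_) (sym (trans (mult-++ (parallel (first-plane n) m) _ (c ∷ x))
                                   (cong (mult (parallel (first-plane n) m) (c ∷ x) +_) (mult-lift (axes m n) c x))))
    (first c (x≤m zero))
  where
  IH : support x ≤ mult (axes m n) x
  IH = axes-cover m x (λ i → x≤m (suc i))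

  first : ∀ c → c ≤ m → support (c ∷ x) ≤ mult (parallel (first-plane n) m) (c ∷ x) + mult (axes m n) x
  first zero    _   = ℕₚ.m≤n⇒m≤o+n _ IH
  first (suc c) c<m = ℕₚ.+-mono-≤ (parallel-covers (first-plane n) m on-plane z<s c<m) IH
    where
    on-plane : (suc c ∷ x) ∈H first-plane n (suc c)
    on-plane = trans (cong₂ _+ℚ_ (ℚₚ.*-identityˡ (ℕ→ℚ (suc c))) (dot-zeros x)) (ℚₚ.+-identityʳ (ℕ→ℚ (suc c)))

axes-off0 : ∀ m n → Off0 (axes m n)
axes-off0 m zero    = []
axes-off0 m (suc n) = Allₚ.++⁺ (parallel-off0 (λ _ → refl) m) (Allₚ.map⁺ (axes-off0 m n))

length-axes : ∀ m n → length (axes m n) ≡ n * m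
length-axes m zero    = refl
length-axes m (suc n) = begin
  length (parallel (first-plane n) m ++ List.map lift (axes m n))            ≡⟨ Listₚ.length-++ (parallel (first-plane n) m) ⟩
  length (parallel (first-plane n) m) + length (List.map lift (axes m n))    ≡⟨ cong₂ _+_ (length-parallel (first-plane n) m) (trans (Listₚ.length-map lift (axes m n)) (length-axes m n)) ⟩
  m + n * m                                                                  ∎
  where open ≡-Reasoning

sum≤support*m : ∀ {n} m (x : Vec ℕ n) → InGrid m x → sum x ≤ support x * m
sum≤support*m m []          _   = z≤n
sum≤support*m m (zero ∷ x)  x≤m = sum≤support*m m x (λ i → x≤m (suc i))
sum≤support*m m (suc c ∷ x) x≤m = ℕₚ.+-mono-≤ (x≤m zero) (sum≤support*m m x (λ i → x≤m (suc i)))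

sum≡0⇒origin : ∀ {n} (x : Vec ℕ n) → sum x ≡ 0 → x ≡ origin
sum≡0⇒origin []         _  = refl
sum≡0⇒origin (zero ∷ x) eq = cong (0 ∷_) (sum≡0⇒origin x eq)

-- For each r < k, the planes x₁ + … + xₙ = j with 1 ≤ j ≤ r m. A point with t nonzero
-- coordinates has coordinate sum at most t m, so it lies on such a plane for every r ≥ t.
layers : ℕ → ∀ n → ℕ → List (Hyperplane (suc n))
layers m n zero    = []
layers m n (suc r) = parallel (sum-plane n) (r * m) ++ layers m n r

-- The bound `k ∸ t` counts the layers r with t ≤ r < k, each of which contains the point.
layers-cover : ∀ {n} m (x : Vec ℕ (suc n)) t → 0 < sum x → sum x ≤ t * m → ∀ k → k ∸ t ≤ mult (layers m n k) x
layers-cover m x t 0<s s≤tm zero = subst (_≤ 0) (sym (ℕₚ.0∸n≡0 t)) z≤n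
layers-cover {n} m x t 0<s s≤tm (suc r) with t ℕₚ.≤? r
... | no  t≰r = subst (_≤ mult (layers m n (suc r)) x) (sym (ℕₚ.m≤n⇒m∸n≡0 (ℕₚ.≰⇒> t≰r))) z≤n
... | yes t≤r = begin
  suc r ∸ t                                                        ≡⟨ ℕₚ.+-∸-assoc 1 t≤r ⟩
  1 + (r ∸ t)                                                      ≤⟨ ℕₚ.+-mono-≤
      (parallel-covers (sum-plane n) (r * m) (dot-ones x) 0<s (ℕₚ.≤-trans s≤tm (ℕₚ.*-monoˡ-≤ m t≤r)))
      (layers-cover m x t 0<s s≤tm r) ⟩
  mult (parallel (sum-plane n) (r * m)) x + mult (layers m n r) x  ≡⟨ mult-++ (parallel (sum-plane n) (r * m)) _ x ⟨
  mult (layers m n (suc r)) x                                      ∎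
  where open ℕₚ.≤-Reasoning

layers-off0 : ∀ m n k → Off0 (layers m n k)
layers-off0 m n zero    = []
layers-off0 m n (suc r) = Allₚ.++⁺ (parallel-off0 (λ _ → refl) (r * m)) (layers-off0 m n r)

-- Summed over all r < k this gives m (0 + 1 + ... + (k - 1)), which is m times the binomial
-- coefficient in the upper bound.
length-layers : ∀ m n r → length (layers m n (suc r)) ≡ r * m + length (layers m n r)
length-layers m n r = trans (Listₚ.length-++ (parallel (sum-plane n) (r * m)))
  (cong (_+ length (layers m n r)) (length-parallel (sum-plane n) (r * m)))

family : ∀ m n k → List (Hyperplane (suc n))
family m n k = axes m (suc n) ++ layers m n k

-- A point with t nonzero coordinates is covered at least t times by `axes` and at least `k ∸ t`
-- times by `layers`.
family-valid : ∀ m n k → Valid m (suc n) k (family m n k)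
family-valid m n k = covers , mult-origin (Allₚ.++⁺ (axes-off0 m (suc n)) (layers-off0 m n k))
  where
  covers : ∀ x → InGrid m x → ¬ x ≡ origin → k ≤ mult (family m n k) x
  covers x x≤m x≢0 = begin
    k                                                ≤⟨ ℕₚ.m≤n+m∸n k (support x) ⟩
    support x + (k ∸ support x)                      ≤⟨ ℕₚ.+-mono-≤ (axes-cover m x x≤m)
        (layers-cover m x (support x) (ℕₚ.n≢0⇒n>0 λ eq → x≢0 (sum≡0⇒origin x eq)) (sum≤support*m m x x≤m) k) ⟩
    mult (axes m (suc n)) x + mult (layers m n k) x  ≡⟨ mult-++ (axes m (suc n)) _ x ⟨
    mult (family m n k) x                            ∎
    where open ℕₚ.≤-Reasoning

length-family : ∀ m n k → length (family m n k) ≡ m * suc n + length (layers m n k)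
length-family m n k = trans (Listₚ.length-++ (axes m (suc n)))
  (cong (_+ length (layers m n k)) (trans (length-axes m (suc n)) (ℕₚ.*-comm (suc n) m)))

length-layers₂ : ∀ m n → length (layers m n 2) ≡ m
length-layers₂ m n = trans (length-layers m n 1) (trans (ℕₚ.+-identityʳ _) (ℕₚ.*-identityˡ m))

length-layers₃ : ∀ m n → length (layers m n 3) ≡ m * 3
length-layers₃ m n = trans (length-layers m n 2) (trans (cong (2 * m +_) (length-layers₂ m n)) (collect m))
  where
  collect : ∀ m → 2 * m + m ≡ m * 3
  collect = solve-∀

length-layers₄ : ∀ m n → length (layers m n 4) ≡ m * 6
length-layers₄ m n = trans (length-layers m n 3) (trans (cong (3 * m +_) (length-layers₃ m n)) (collect m))
  where
  collect : ∀ m → 3 * m + m * 3 ≡ m * 6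
  collect = solve-∀

theorem1p4 : ((m n : ℕ) → 1 ≤ m → 2 ≤ n →
    Σ (List (Hyperplane n)) (λ F → Valid m n 2 F × length F ≡ m * n + m)
    × ((F : List (Hyperplane n)) → Valid m n 2 F → m * n + m ≤ length F))
    × ((m n k : ℕ) → 1 ≤ m → 1 ≤ n → (k ≡ 3 ⊎ k ≡ 4) → k ∸ 1 ≤ n →
    ((F : List (Hyperplane n)) → Valid m n k F →
    m * n + (m + 1) * (k ∸ 1) ∸ 1 ≤ length F)
    × Σ (List (Hyperplane n)) (λ F → Valid m n k F × length F ≤ m * n + m * (k C 2)))
theorem1p4 = two , three-four
  where
  two : (m n : ℕ) → 1 ≤ m → 2 ≤ n →
    Σ (List (Hyperplane n)) (λ F → Valid m n 2 F × length F ≡ m * n + m)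
    × ((F : List (Hyperplane n)) → Valid m n 2 F → m * n + m ≤ length F)
  two m (suc n) _ _ =
    (family m n 2 , family-valid m n 2 ,
      trans (length-family m n 2) (cong (m * suc n +_) (length-layers₂ m n))) ,
    lower-bound₂ m n

  three-four : (m n k : ℕ) → 1 ≤ m → 1 ≤ n → (k ≡ 3 ⊎ k ≡ 4) → k ∸ 1 ≤ n →
    ((F : List (Hyperplane n)) → Valid m n k F →
    m * n + (m + 1) * (k ∸ 1) ∸ 1 ≤ length F)
    × Σ (List (Hyperplane n)) (λ F → Valid m n k F × length F ≤ m * n + m * (k C 2))
  -- The bound k - 1 ≤ n provides the coordinates that carry shapes other than (1 , 1); `3 C 2` and
  -- `4 C 2` evaluate to 3 and 6.
  three-four m (suc (suc n)) _ 1≤m _ (inj₁ refl) (s≤s (s≤s z≤n)) =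
    lower-bound₃ m n 1≤m ,
    (family m (suc n) 3 , family-valid m (suc n) 3 ,
      ℕₚ.≤-reflexive (trans (length-family m (suc n) 3) (cong (m * (2 + n) +_) (length-layers₃ m (suc n)))))
  three-four m (suc (suc (suc n))) _ 1≤m _ (inj₂ refl) (s≤s (s≤s (s≤s z≤n))) =
    lower-bound₄ m n 1≤m ,
    (family m (2 + n) 4 , family-valid m (2 + n) 4 ,
      ℕₚ.≤-reflexive (trans (length-family m (2 + n) 4) (cong (m * (3 + n) +_) (length-layers₄ m (2 + n)))))
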